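{- There is a one-pass streaming algorithm using $\widetilde{O}(n)$ memory that, given an $n$-vertex simple graph $G=(V,E)$ in the complete vertex arrival setting, computes the edge connectivity of $G$ with high probability.
   Context: A simple graph is undirected, unweighted, loopless, with at most one edge per pair of vertices. The edge connectivity is $\lambda(G)=\min_{\emptyset\ne S\subsetneq V}|\mathrm{cut}_G(S)|$, where $\mathrm{cut}_G(S)$ is the set of edges with exactly one endpoint in $S$. In the complete vertex arrival setting, the vertices of $G$ arrive one by one in an arbitrary (adversarial) order, and each vertex arrives together with all of its incident edges. $\widetilde{O}$ hides polylogarithmic factors in $n$; "with high probability" means with probability $1-1/\mathrm{poly}(n)$. -}

module Defs where

open import Data.Nat using (ℕ; zero; suc; _+_; _*_; _^_; _≤_)
open import Data.Nat.Logarithm using (⌊log₂_⌋)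
open import Data.Bool using (Bool; true; false; _∧_; not; if_then_else_)
open import Data.Fin using (Fin)
open import Data.List using (List; []; _∷_; map; allFin; length)
open import Data.Nat.ListAction using (sum)
open import Data.List.Relation.Unary.All using (All)
open import Data.Vec using (Vec)
open import Data.Product using (Σ; ∃; _×_)
open import Relation.Binary.PropositionalEquality using (_≡_)

record Graph (n : ℕ) : Set where
  field
    adj   : Fin n → Fin n → Bool
    sym   : ∀ u v → adj u v ≡ adj v u
    loopless : ∀ u → adj u u ≡ false
open Graph public

VSet : ℕ → Set
VSet n = Fin n → Bool

NonemptyProper : {n : ℕ} → VSet n → Set
NonemptyProper {n} S = (∃ λ u → S u ≡ true) × (∃ λ v → S v ≡ false)

-- |cut_G(S)|: each edge with exactly one endpoint in S is counted exactly once,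
-- as the ordered pair (endpoint in S, endpoint outside S).
cutSize : {n : ℕ} → Graph n → VSet n → ℕ
cutSize {n} G S =
  sum (map (λ u → sum (map (λ v → if S u ∧ not (S v) ∧ adj G u v then 1 else 0)
                           (allFin n)))
           (allFin n))

IsEdgeConnectivity : {n : ℕ} → Graph n → ℕ → Set
IsEdgeConnectivity {n} G k =
  (Σ (VSet n) λ S → NonemptyProper S × cutSize G S ≡ k) ×
  (∀ (S : VSet n) → NonemptyProper S → k ≤ cutSize G S)

Memory : Set
Memory = List Bool

-- A one-pass randomized streaming algorithm for n-vertex graphs in the complete
-- vertex arrival setting.  It draws `randBits` uniformly random bits at the start;
-- `init` builds the initial memory from them (so any randomness used later must be
-- stored in memory and counts towards space).  Each stream item is a vertex together
-- with all its incident edges (its adjacency row).  `output` is the answer.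
record StreamAlg (n : ℕ) : Set where
  field
    randBits : ℕ
    init     : Vec Bool randBits → Memory
    step     : Memory → Fin n → (Fin n → Bool) → Memory
    output   : Memory → ℕ
open StreamAlg public

module _ {n : ℕ} (A : StreamAlg n) (G : Graph n) where
  states : Memory → List (Fin n) → List Memory
  states m [] = m ∷ []
  states m (v ∷ vs) = m ∷ states (step A m v (adj G v)) vs

  final : Memory → List (Fin n) → Memory
  final m [] = m
  final m (v ∷ vs) = final (step A m v (adj G v)) vs

softLinear : ℕ → ℕ → ℕ → ℕ
softLinear K k n = K * n * (suc ⌊log₂ n ⌋) ^ k

{-# OPTIONS --safe #-}
module Submission where

-- Star contraction. For every scale k = 2^i keep a random table R of about (n/k) log n
-- centers; an arriving vertex v is relabelled by a random center f v among its neighbours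
-- in R, and each edge uv is inserted as f u – f v when its second endpoint arrives, into a
-- sparse certificate that keeps every cut of size below 2k exact. There are few centers, so
-- the certificate has O(n log n) edges, and each small cut T of it is the cut T ∘ f of G.
--
-- Suppose a minimum cut S is smaller than every degree, and let k ≤ 1 + |cut S| and
-- |cut S| < 2k. Moving one vertex cannot shrink the cut, so every v has at most as many
-- crossing as non-crossing edges, and there are at most 4k crossing (v, u) in total. By an
-- exponential moment bound, with constant probability every v has a constant fraction of its
-- neighbours in R on its own side, and the expected number of v with f v across the cut is
-- O(1); as the choices are independent, S ∘ f = S with constant probability. O(log n)
-- repetitions make failure polynomially unlikely. All candidate values are sizes of true
-- cuts, so the minimum of these and of the degrees is never too small.

-- Probabilities are counts of bit strings, and every estimate is an inequality of natural numbers
-- with the denominators multiplied out. The expected number of labels across the cut is bounded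
-- only by a large constant, so a union bound over the vertices is useless. Independence helps
-- instead: once each single failure probability is at most 3/4, a product of success probabilities
-- with bounded failure sum is bounded below (`∏-lower`). The bound 3/4 must hold at all vertices
-- simultaneously, and this is why the table carries the factor `gap b`, of order log n; the same
-- factor enlarges every neighbourhood in the table and so cancels from the expected number of
-- failures. Small degrees are treated apart because a vertex alone on its side of the cut has all
-- its neighbours across. All random bits belong to the stored state, so tables and choices are
-- charged to the memory. Time is not charged: the certificate and the output search all vertex sets
-- exhaustively.

open import Defs
open import Data.Nat
open import Data.Nat.Properties
open import Data.Nat.DivMod using (_%_; _/_; m≡m%n+[m/n]*n; m%n<n; [m+n]%n≡m%n; m<n⇒m%n≡m; m/n*n≤m)
open import Data.Nat.Induction using (<-wellFounded; Acc; acc)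
open import Data.Nat.ListAction using (sum; product)
open import Data.Nat.ListAction.Properties using (sum-++; sum-↭)
open import Data.Nat.Logarithm
open import Data.Nat.Tactic.RingSolver using (solve-∀)
open import Data.Bool using (Bool; true; false; _∧_; not; _xor_; if_then_else_; T)
open import Data.Bool.ListAction using (all; any; or)
open import Data.Bool.Properties using (not-involutive; ∧-zeroʳ; T?)
open import Data.Fin using (Fin; zero; suc; toℕ)
import Data.Fin as Fin
open import Data.Fin.Properties using (toℕ<n)
open import Data.List using (List; []; _∷_; map; allFin; length; _++_; _ʳ++_; filterᵇ; foldr; catMaybes; concat; replicate; upTo; concatMap)
import Data.List.Properties as List
open import Data.List.Membership.Propositional using (_∈_; _∉_)
import Data.List.Membership.Propositional.Properties as Mem
open import Data.List.Relation.Unary.All using (All; []; _∷_)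
import Data.List.Relation.Unary.All as All
import Data.List.Relation.Unary.All.Properties as All
open import Data.List.Relation.Unary.AllPairs using (_∷_)
open import Data.List.Relation.Unary.Any using (here; there)
open import Data.List.Relation.Unary.Unique.Propositional using (Unique)
open import Data.List.Relation.Unary.Unique.Propositional.Properties using (allFin⁺)
open import Data.List.Relation.Binary.Permutation.Propositional using (_↭_; ↭-sym; ↭-trans; ↭⇒↭ₛ)
import Data.List.Relation.Binary.Permutation.Propositional.Properties as Perm
import Data.List.Relation.Binary.Permutation.Setoid.Properties as PermS
open import Data.Vec using (Vec; []; _∷_; take; drop; lookup)
import Data.Vec as Vec
import Data.Vec.Properties as Vec
open import Data.Maybe using (Maybe; just; nothing; maybe′; fromMaybe)
import Data.Maybe as Maybe
open import Data.Product using (Σ; ∃; _×_; _,_; proj₁; proj₂)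
open import Data.Sum using (_⊎_; inj₁; inj₂)
open import Data.Empty using (⊥-elim)
open import Function using (_∘_; id; const)
open import Relation.Nullary using (yes; no; does)
open import Relation.Binary.PropositionalEquality renaming (sym to ≡-sym)

private variable
  A B : Set

-- Finite sums and bit strings

∑ : List A → (A → ℕ) → ℕ
∑ xs f = sum (map f xs)

∏ : List A → (A → ℕ) → ℕ
∏ xs f = product (map f xs)

𝟙 : Bool → ℕ
𝟙 x = if x then 1 else 0

+-interchange : ∀ a b c d → (a + b) + (c + d) ≡ (a + c) + (b + d)
+-interchange = solve-∀

∑-cong : (xs : List A) {f g : A → ℕ} → (∀ x → f x ≡ g x) → ∑ xs f ≡ ∑ xs g
∑-cong []       e = refl
∑-cong (x ∷ xs) e = cong₂ _+_ (e x) (∑-cong xs e)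

∑-mono : (xs : List A) {f g : A → ℕ} → (∀ x → f x ≤ g x) → ∑ xs f ≤ ∑ xs g
∑-mono []       e = z≤n
∑-mono (x ∷ xs) e = +-mono-≤ (e x) (∑-mono xs e)

∑-+ : (xs : List A) (f g : A → ℕ) → ∑ xs (λ x → f x + g x) ≡ ∑ xs f + ∑ xs g
∑-+ []       f g = refl
∑-+ (x ∷ xs) f g = trans (cong (f x + g x +_) (∑-+ xs f g))
                         (+-interchange (f x) (g x) (∑ xs f) (∑ xs g))

∑-*ʳ : (xs : List A) (f : A → ℕ) (c : ℕ) → ∑ xs (λ x → f x * c) ≡ ∑ xs f * c
∑-*ʳ []       f c = refl
∑-*ʳ (x ∷ xs) f c = trans (cong (f x * c +_) (∑-*ʳ xs f c)) (≡-sym (*-distribʳ-+ c (f x) _))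

∑-*ˡ : (xs : List A) (f : A → ℕ) (c : ℕ) → ∑ xs (λ x → c * f x) ≡ c * ∑ xs f
∑-*ˡ xs f c = trans (∑-cong xs (λ x → *-comm c (f x))) (trans (∑-*ʳ xs f c) (*-comm _ c))

∑-const : (xs : List A) (c : ℕ) → ∑ xs (const c) ≡ length xs * c
∑-const []       c = refl
∑-const (x ∷ xs) c = cong (c +_) (∑-const xs c)

∑-zero : (xs : List A) → ∑ xs (const 0) ≡ 0
∑-zero xs = trans (∑-const xs 0) (*-zeroʳ (length xs))

∑-swap : (xs : List A) (ys : List B) (f : A → B → ℕ) →
         ∑ xs (λ x → ∑ ys (f x)) ≡ ∑ ys (λ y → ∑ xs (λ x → f x y))
∑-swap []       ys f = ≡-sym (∑-zero ys)
∑-swap (x ∷ xs) ys f = trans (cong (∑ ys (f x) +_) (∑-swap xs ys f)) (≡-sym (∑-+ ys (f x) _))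

∑-++ : (xs ys : List A) (f : A → ℕ) → ∑ (xs ++ ys) f ≡ ∑ xs f + ∑ ys f
∑-++ xs ys f = trans (cong sum (List.map-++ f xs ys)) (sum-++ (map f xs) (map f ys))

∑-map : (xs : List A) (h : A → B) (f : B → ℕ) → ∑ (map h xs) f ≡ ∑ xs (f ∘ h)
∑-map xs h f = cong sum (≡-sym (List.map-∘ xs))

∑-↭ : {xs ys : List A} (f : A → ℕ) → xs ↭ ys → ∑ xs f ≡ ∑ ys f
∑-↭ f p = sum-↭ (Perm.map⁺ f p)

∑-filter : (xs : List A) (p : A → Bool) (f : A → ℕ) →
           ∑ (filterᵇ p xs) f ≡ ∑ xs (λ x → if p x then f x else 0)
∑-filter []       p f = refl
∑-filter (x ∷ xs) p f with p x
... | true  = cong (f x +_) (∑-filter xs p f)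
... | false = ∑-filter xs p f

length≡∑ : (xs : List A) → length xs ≡ ∑ xs (const 1)
length≡∑ xs = ≡-sym (trans (∑-const xs 1) (*-identityʳ _))

length-filter≡∑ : (xs : List A) (p : A → Bool) → length (filterᵇ p xs) ≡ ∑ xs (𝟙 ∘ p)
length-filter≡∑ xs p = trans (length≡∑ (filterᵇ p xs)) (∑-filter xs p (const 1))

∈⇒≤∑ : {xs : List A} {x : A} (f : A → ℕ) → x ∈ xs → f x ≤ ∑ xs f
∈⇒≤∑ {xs = x ∷ xs} f (here refl) = m≤m+n (f x) _
∈⇒≤∑ {xs = y ∷ xs} f (there i)   = ≤-trans (∈⇒≤∑ f i) (m≤n+m _ (f y))

∑-cong-∈ : (xs : List A) {f g : A → ℕ} → (∀ {x} → x ∈ xs → f x ≡ g x) → ∑ xs f ≡ ∑ xs g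
∑-cong-∈ []       e = refl
∑-cong-∈ (x ∷ xs) e = cong₂ _+_ (e (here refl)) (∑-cong-∈ xs (e ∘ there))

markov : (xs : List A) (f : A → ℕ) (t : ℕ) → ∑ xs (λ x → 𝟙 (t ≤ᵇ f x)) * t ≤ ∑ xs f
markov xs f t = ≤-trans (≤-reflexive (≡-sym (∑-*ʳ xs _ t))) (∑-mono xs pointwise)
  where
  pointwise : ∀ x → 𝟙 (t ≤ᵇ f x) * t ≤ f x
  pointwise x with t ≤ᵇ f x | ≤ᵇ⇒≤ t (f x)
  ... | true  | le = ≤-trans (≤-reflexive (*-identityˡ t)) (le _)
  ... | false | _  = z≤n

∑< : ℕ → (ℕ → ℕ) → ℕ
∑< zero    f = 0
∑< (suc n) f = f 0 + ∑< n (f ∘ suc)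

∑<-cong : ∀ n {f g : ℕ → ℕ} → (∀ i → i < n → f i ≡ g i) → ∑< n f ≡ ∑< n g
∑<-cong zero    e = refl
∑<-cong (suc n) e = cong₂ _+_ (e 0 (s≤s z≤n)) (∑<-cong n (λ i l → e (suc i) (s≤s l)))

∑<-+ : ∀ m n f → ∑< (m + n) f ≡ ∑< m f + ∑< n (λ i → f (m + i))
∑<-+ zero    n f = refl
∑<-+ (suc m) n f = trans (cong (f 0 +_) (∑<-+ m n (f ∘ suc))) (≡-sym (+-assoc (f 0) _ _))

∑<-const : ∀ n c → ∑< n (const c) ≡ n * c
∑<-const zero    c = refl
∑<-const (suc n) c = cong (c +_) (∑<-const n c)

∑<-mono : ∀ {m n} f → m ≤ n → ∑< m f ≤ ∑< n f
∑<-mono f z≤n     = z≤n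
∑<-mono f (s≤s l) = +-monoʳ-≤ (f 0) (∑<-mono (f ∘ suc) l)

bits : ∀ k → List (Vec Bool k)
bits zero    = [] ∷ []
bits (suc k) = map (false ∷_) (bits k) ++ map (true ∷_) (bits k)

∑-bits-suc : ∀ k (f : Vec Bool (suc k) → ℕ) →
             ∑ (bits (suc k)) f ≡ ∑ (bits k) (f ∘ (false ∷_)) + ∑ (bits k) (f ∘ (true ∷_))
∑-bits-suc k f = trans (∑-++ (map (false ∷_) (bits k)) _ f)
                       (cong₂ _+_ (∑-map (bits k) (false ∷_) f) (∑-map (bits k) (true ∷_) f))

∈-bits : ∀ {k} (x : Vec Bool k) → x ∈ bits k
∈-bits []          = here refl
∈-bits (false ∷ x) = Mem.∈-++⁺ˡ (Mem.∈-map⁺ (false ∷_) (∈-bits x))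
∈-bits (true  ∷ x) = Mem.∈-++⁺ʳ (map (false ∷_) (bits _)) (Mem.∈-map⁺ (true ∷_) (∈-bits x))

length-bits : ∀ k → length (bits k) ≡ 2 ^ k
length-bits zero    = refl
length-bits (suc k) = trans (length≡∑ (bits (suc k))) (trans (∑-bits-suc k (const 1))
  (trans (cong₂ _+_ eq eq) (cong (2 ^ k +_) (≡-sym (+-identityʳ (2 ^ k))))))
  where eq = trans (≡-sym (length≡∑ (bits k))) (length-bits k)

∑-bits-const : ∀ k c → ∑ (bits k) (const c) ≡ 2 ^ k * c
∑-bits-const k c = trans (∑-const (bits k) c) (cong (_* c) (length-bits k))

-- Fubini for a string read in two parts; this is how independence of disjoint bits enters every
-- later count.
∑-bits-+ : ∀ m n (f : Vec Bool m → Vec Bool n → ℕ) →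
           ∑ (bits (m + n)) (λ x → f (take m x) (drop m x))
             ≡ ∑ (bits m) (λ x → ∑ (bits n) (f x))
∑-bits-+ zero    n f = ≡-sym (+-identityʳ _)
∑-bits-+ (suc m) n f = trans (∑-bits-suc (m + n) _)
  (trans (cong₂ _+_ (∑-bits-+ m n (f ∘ (false ∷_))) (∑-bits-+ m n (f ∘ (true ∷_))))
         (≡-sym (∑-bits-suc m (λ x → ∑ (bits n) (f x)))))

∑-bits-* : ∀ m n (f : Vec Bool m → ℕ) (g : Vec Bool n → ℕ) →
           ∑ (bits (m + n)) (λ x → f (take m x) * g (drop m x)) ≡ ∑ (bits m) f * ∑ (bits n) g
∑-bits-* m n f g = trans (∑-bits-+ m n (λ x y → f x * g y))
  (trans (∑-cong (bits m) (λ x → ∑-*ˡ (bits n) g (f x))) (∑-*ʳ (bits m) f (∑ (bits n) g)))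

value : ∀ {k} → Vec Bool k → ℕ
value []                  = 0
value {suc k} (false ∷ x) = value x
value {suc k} (true  ∷ x) = 2 ^ k + value x

∑-value : ∀ k f → ∑ (bits k) (f ∘ value) ≡ ∑< (2 ^ k) f
∑-value zero    f = refl
∑-value (suc k) f = trans (∑-bits-suc k (f ∘ value))
  (trans (cong₂ _+_ (∑-value k f) (∑-value k (f ∘ (2 ^ k +_))))
  (trans (≡-sym (∑<-+ (2 ^ k) (2 ^ k) f))
         (cong (λ z → ∑< (2 ^ k + z) f) (≡-sym (+-identityʳ (2 ^ k))))))

binary : ∀ k → ℕ → Vec Bool k
binary zero    i = []
binary (suc k) i = if i <ᵇ 2 ^ k then false ∷ binary k i else true ∷ binary k (i ∸ 2 ^ k)

value-binary : ∀ k i → i < 2 ^ k → value (binary k i) ≡ i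
value-binary zero    zero    l = refl
value-binary zero    (suc i) (s≤s ())
value-binary (suc k) i l with i <ᵇ 2 ^ k | <ᵇ⇒< i (2 ^ k) | <⇒<ᵇ {i} {2 ^ k}
... | true  | lt | _  = value-binary k i (lt _)
... | false | _  | ge = trans (cong (2 ^ k +_) (value-binary k (i ∸ 2 ^ k) lt)) (m+[n∸m]≡n le)
  where
  le : 2 ^ k ≤ i
  le = ≮⇒≥ ge
  lt : i ∸ 2 ^ k < 2 ^ k
  lt = +-cancelˡ-< (2 ^ k) _ _ (subst₂ _<_ (≡-sym (m+[n∸m]≡n le)) (cong (2 ^ k +_) (+-identityʳ _)) l)

∑-allFin-suc : ∀ n (f : Fin (suc n) → ℕ) →
               ∑ (allFin (suc n)) f ≡ f zero + ∑ (allFin n) (f ∘ suc)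
∑-allFin-suc n f = cong (λ z → f zero + sum z)
  (trans (List.map-tabulate suc f) (≡-sym (List.map-tabulate id (f ∘ suc))))

∏-allFin-suc : ∀ n (f : Fin (suc n) → ℕ) →
               ∏ (allFin (suc n)) f ≡ f zero * ∏ (allFin n) (f ∘ suc)
∏-allFin-suc n f = cong (λ z → f zero * product z)
  (trans (List.map-tabulate suc f) (≡-sym (List.map-tabulate id (f ∘ suc))))

-- Random samples

fromℕ? : ∀ n → ℕ → Maybe (Fin n)
fromℕ? zero    i       = nothing
fromℕ? (suc n) zero    = just zero
fromℕ? (suc n) (suc i) = Maybe.map suc (fromℕ? n i)

fromℕ?-toℕ : ∀ {n} (u : Fin n) → fromℕ? n (toℕ u) ≡ just u
fromℕ?-toℕ zero    = refl
fromℕ?-toℕ (suc u) = cong (Maybe.map suc) (fromℕ?-toℕ u)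

-- The indices from `n` on contribute `(N ∸ n) * g nothing`; the extra term on the left avoids the
-- truncated subtraction.
∑<-fromℕ? : ∀ {n N} → n ≤ N → (g : Maybe (Fin n) → ℕ) →
            ∑< N (g ∘ fromℕ? n) + n * g nothing ≡ ∑ (allFin n) (g ∘ just) + N * g nothing
∑<-fromℕ? {N = N} z≤n g = trans (+-identityʳ _) (∑<-const N (g nothing))
∑<-fromℕ? {suc n} {suc N} (s≤s l) g = begin
  (a + X) + (y + n * y)                          ≡⟨ rearr a X y (n * y) ⟩
  a + y + (X + n * y)                            ≡⟨ cong (a + y +_) (∑<-fromℕ? l (g ∘ Maybe.map suc)) ⟩
  a + y + (∑ (allFin n) (g ∘ just ∘ suc) + N * y) ≡⟨ rearr′ a y _ (N * y) ⟩
  a + ∑ (allFin n) (g ∘ just ∘ suc) + (y + N * y) ≡⟨ cong (_+ (y + N * y)) (≡-sym (∑-allFin-suc n (g ∘ just))) ⟩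
  ∑ (allFin (suc n)) (g ∘ just) + suc N * y      ∎
  where
  open ≡-Reasoning
  a = g (just zero)
  y = g nothing
  X = ∑< N (g ∘ Maybe.map suc ∘ fromℕ? n)
  rearr : ∀ a x y z → (a + x) + (y + z) ≡ a + y + (x + z)
  rearr = solve-∀
  rearr′ : ∀ a x y z → a + x + (y + z) ≡ a + y + (x + z)
  rearr′ = solve-∀

nth : A → List A → ℕ → A
nth d []       i       = d
nth d (x ∷ xs) zero    = x
nth d (x ∷ xs) (suc i) = nth d xs i

-- The default z is returned only when the list is empty.
pick : A → List A → ℕ → A
pick z []       ρ = z
pick z (x ∷ xs) ρ = nth x (x ∷ xs) (ρ % length (x ∷ xs))

∑<-nth : (d : A) (xs : List A) (h : A → ℕ) → ∑< (length xs) (h ∘ nth d xs) ≡ ∑ xs h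
∑<-nth d []       h = refl
∑<-nth d (x ∷ xs) h = cong (h x +_) (∑<-nth d xs h)

nth-∈ : (d : A) (xs : List A) (i : ℕ) → nth d xs i ∈ d ∷ xs
nth-∈ d []       i       = here refl
nth-∈ d (x ∷ xs) zero    = there (here refl)
nth-∈ d (x ∷ xs) (suc i) with nth-∈ d xs i
... | here e  = here e
... | there j = there (there j)

pick-∈ : (z : A) (xs : List A) (ρ : ℕ) → pick z xs ρ ∈ z ∷ xs
pick-∈ z []       ρ = here refl
pick-∈ z (x ∷ xs) ρ with nth-∈ x (x ∷ xs) (ρ % length (x ∷ xs))
... | here e  = there (here e)
... | there j = there j

∑<-% : ∀ d .{{_ : NonZero d}} q (h : ℕ → ℕ) → ∑< (q * d) (λ i → h (i % d)) ≡ q * ∑< d h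
∑<-% d zero    h = refl
∑<-% d (suc q) h = trans (∑<-+ d (q * d) _) (cong₂ _+_
  (∑<-cong d (λ i l → cong h (m<n⇒m%n≡m l)))
  (trans (∑<-cong (q * d) (λ i _ → cong h (trans (cong (_% d) (+-comm d i)) ([m+n]%n≡m%n i d))))
         (∑<-% d q h)))

-- Reduction modulo the length `d` hits each entry at most `D / d + 1` times. The bias towards the
-- first entries therefore costs a factor of at most `(D + d) / D`, which is close to one when `D`
-- is large.
∑<-pick : ∀ (z : A) (xs : List A) D (h : A → ℕ) → 0 < length xs →
          ∑< D (h ∘ pick z xs) * length xs ≤ (D + length xs) * ∑ xs h
∑<-pick z (x ∷ xs) D h _ = begin
  ∑< D f * d             ≤⟨ *-monoˡ-≤ d (∑<-mono f D≤) ⟩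
  ∑< (suc (D / d) * d) f * d ≡⟨ cong (_* d) (∑<-% d (suc (D / d)) (h ∘ nth x (x ∷ xs))) ⟩
  suc (D / d) * ∑< d (h ∘ nth x (x ∷ xs)) * d ≡⟨ cong (λ y → suc (D / d) * y * d) (∑<-nth x (x ∷ xs) h) ⟩
  suc (D / d) * s * d    ≡⟨ rearr (D / d) s d ⟩
  (D / d * d + d) * s    ≤⟨ *-monoˡ-≤ s (+-monoˡ-≤ d (m/n*n≤m D d)) ⟩
  (D + d) * s            ∎
  where
  open ≤-Reasoning
  d = length (x ∷ xs)
  s = ∑ (x ∷ xs) h
  f = h ∘ pick z (x ∷ xs)
  rearr : ∀ q s d → (1 + q) * s * d ≡ (q * d + d) * s
  rearr = solve-∀
  D≤ : D ≤ suc (D / d) * d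
  D≤ = begin
    D                    ≡⟨ m≡m%n+[m/n]*n D d ⟩
    D % d + D / d * d    ≤⟨ +-monoˡ-≤ (D / d * d) (<⇒≤ (m%n<n D d)) ⟩
    suc (D / d) * d      ∎

module _ {n b : ℕ} where
  -- A string whose value is not below `n` yields `nothing` rather than being reduced, so for
  -- `n ≤ 2 ^ b` each vertex is drawn with probability exactly `1 / 2 ^ b`.
  sample : Vec Bool b → Maybe (Fin n)
  sample x = fromℕ? n (value x)

  ∑-sample : n ≤ 2 ^ b → (g : Maybe (Fin n) → ℕ) →
             ∑ (bits b) (g ∘ sample) + n * g nothing ≡ ∑ (allFin n) (g ∘ just) + 2 ^ b * g nothing
  ∑-sample l g = trans (cong (_+ n * g nothing) (∑-value b (g ∘ fromℕ? n))) (∑<-fromℕ? l g)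

  samples : ∀ m → Vec Bool (m * b) → List (Maybe (Fin n))
  samples zero    x = []
  samples (suc m) x = sample (take b x) ∷ samples m (drop b x)

  length-samples : ∀ m x → length (samples m x) ≡ m
  length-samples zero    x = refl
  length-samples (suc m) x = cong suc (length-samples m (drop b x))

  ∑-∏-samples : ∀ m (g : Maybe (Fin n) → ℕ) →
                ∑ (bits (m * b)) (λ x → ∏ (samples m x) g) ≡ ∑ (bits b) (g ∘ sample) ^ m
  ∑-∏-samples zero    g = refl
  ∑-∏-samples (suc m) g = trans
    (∑-bits-* b (m * b) (g ∘ sample) (λ y → ∏ (samples m y) g))
    (cong (∑ (bits b) (g ∘ sample) *_) (∑-∏-samples m g))

  -- Linearity of expectation, multiplied by `2 ^ b` to clear the denominator of a single draw.
  ∑-∑-samples : ∀ m (g : Maybe (Fin n) → ℕ) →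
                ∑ (bits (m * b)) (λ x → ∑ (samples m x) g) * 2 ^ b
                  ≡ m * ∑ (bits b) (g ∘ sample) * 2 ^ (m * b)
  ∑-∑-samples zero    g = refl
  ∑-∑-samples (suc m) g = begin
    ∑ (bits (b + m * b)) (λ x → ∑ (samples (suc m) x) g) * X
      ≡⟨ cong (_* X) (trans (∑-bits-+ b (m * b) (λ x y → g (sample x) + ∑ (samples m y) g))
           (trans (∑-cong (bits b) (λ x → trans (∑-+ (bits (m * b)) (const (g (sample x))) _)
             (cong (_+ S) (∑-bits-const (m * b) (g (sample x))))))
           (trans (∑-+ (bits b) _ (const S)) (cong₂ _+_ (∑-*ˡ (bits b) (g ∘ sample) Y) (∑-bits-const b S))))) ⟩
    (Y * a + X * S) * X   ≡⟨ rearr X Y S a ⟩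
    Y * a * X + S * X * X ≡⟨ cong (λ z → Y * a * X + z * X) (∑-∑-samples m g) ⟩
    Y * a * X + m * a * Y * X ≡⟨ rearr′ X Y m a ⟩
    suc m * a * (X * Y)   ≡⟨ cong (suc m * a *_) (≡-sym (^-distribˡ-+-* 2 b (m * b))) ⟩
    suc m * a * 2 ^ (suc m * b) ∎
    where
    open ≡-Reasoning
    X = 2 ^ b
    Y = 2 ^ (m * b)
    a = ∑ (bits b) (g ∘ sample)
    S = ∑ (bits (m * b)) (λ x → ∑ (samples m x) g)
    rearr : ∀ X Y S a → (Y * a + X * S) * X ≡ Y * a * X + S * X * X
    rearr = solve-∀
    rearr′ : ∀ X Y m a → Y * a * X + m * a * Y * X ≡ (1 + m) * a * (X * Y)
    rearr′ = solve-∀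

∑-catMaybes : (xs : List (Maybe A)) (f : A → ℕ) → ∑ (catMaybes xs) f ≡ ∑ xs (maybe′ f 0)
∑-catMaybes []             f = refl
∑-catMaybes (just x  ∷ xs) f = cong (f x +_) (∑-catMaybes xs f)
∑-catMaybes (nothing ∷ xs) f = ∑-catMaybes xs f

length-catMaybes-≤ : (xs : List (Maybe A)) → length (catMaybes xs) ≤ length xs
length-catMaybes-≤ []             = z≤n
length-catMaybes-≤ (just x  ∷ xs) = s≤s (length-catMaybes-≤ xs)
length-catMaybes-≤ (nothing ∷ xs) = m≤n⇒m≤1+n (length-catMaybes-≤ xs)

^-distribʳ-* : ∀ m x y → (x * y) ^ m ≡ x ^ m * y ^ m
^-distribʳ-* zero    x y = refl
^-distribʳ-* (suc m) x y = trans (cong (x * y *_) (^-distribʳ-* m x y)) (rearr x y (x ^ m) (y ^ m))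
  where
  rearr : ∀ a b c d → a * b * (c * d) ≡ (a * c) * (b * d)
  rearr = solve-∀

-- The binomial expansion of (1 + x) ^ m, truncated after the linear term.
bernoulli : ∀ x m → x ^ suc m + suc m * x ^ m ≤ suc x ^ suc m
bernoulli x zero    = ≤-reflexive (rearr x)
  where
  rearr : ∀ x → x * 1 + 1 * 1 ≡ (1 + x) * 1
  rearr = solve-∀
bernoulli x (suc m) = begin
  x * (x * p) + (2 + m) * (x * p)                   ≤⟨ m≤m+n _ ((1 + m) * p) ⟩
  x * (x * p) + (2 + m) * (x * p) + (1 + m) * p     ≡⟨ rearr x p m ⟩
  (1 + x) * (x * p + (1 + m) * p)                   ≤⟨ *-monoʳ-≤ (1 + x) (bernoulli x m) ⟩
  suc x * suc x ^ suc m                             ∎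
  where
  open ≤-Reasoning
  p = x ^ m
  rearr : ∀ x p m → x * (x * p) + (2 + m) * (x * p) + (1 + m) * p ≡ (1 + x) * (x * p + (1 + m) * p)
  rearr = solve-∀

2*x^[1+x]≤[1+x]^[1+x] : ∀ x → 2 * x ^ suc x ≤ suc x ^ suc x
2*x^[1+x]≤[1+x]^[1+x] x = begin
  2 * (x * p)            ≤⟨ m≤m+n _ p ⟩
  2 * (x * p) + p        ≡⟨ rearr x p ⟩
  x * p + (1 + x) * p    ≤⟨ bernoulli x x ⟩
  suc x ^ suc x          ∎
  where
  open ≤-Reasoning
  p = x ^ x
  rearr : ∀ x p → 2 * (x * p) + p ≡ x * p + (1 + x) * p
  rearr = solve-∀

-- In fractions, `(1 - 1/(1+x)) ^ ((1+x) t) ≤ 2 ^ (- t)`. It serves twice: for the tail bound of one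
-- table and for the repetition of trials.
x^[[1+x]t]*2^t≤ : ∀ x t → x ^ (suc x * t) * 2 ^ t ≤ suc x ^ (suc x * t)
x^[[1+x]t]*2^t≤ x t = begin
  x ^ (suc x * t) * 2 ^ t   ≡⟨ cong (_* 2 ^ t) (≡-sym (^-*-assoc x (suc x) t)) ⟩
  (x ^ suc x) ^ t * 2 ^ t   ≡⟨ ≡-sym (^-distribʳ-* t (x ^ suc x) 2) ⟩
  (x ^ suc x * 2) ^ t       ≤⟨ ^-monoˡ-≤ t (≤-trans (≤-reflexive (*-comm (x ^ suc x) 2)) (2*x^[1+x]≤[1+x]^[1+x] x)) ⟩
  (suc x ^ suc x) ^ t       ≡⟨ ^-*-assoc (suc x) (suc x) t ⟩
  suc x ^ (suc x * t)       ∎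
  where open ≤-Reasoning

-- Tail bound and products of probabilities

-- An exponential moment for the event 2 * same ≤ cross + L: a crossing element
-- is weighted by 3/2 and a non-crossing one by 4/9 = (3/2)⁻², all scaled by 18.
weight : Bool → Bool → ℕ
weight a x = if a then (if x then 27 else 8) else 18

module _ (a x : A → Bool) where
  private
    w c e : A → ℕ
    w y = weight (a y) (x y)
    c y = 𝟙 (a y ∧ x y)
    e y = 𝟙 (a y ∧ not (x y))

  -- Each weight is 18 times 3/2, 4/9 or 1; the denominators 2 and 9 stand on the left.
  ∏-weight : (xs : List A) → ∏ xs w * (2 ^ ∑ xs c * 9 ^ ∑ xs e)
                               ≡ 18 ^ length xs * (3 ^ ∑ xs c * 4 ^ ∑ xs e)
  ∏-weight [] = refl
  ∏-weight (y ∷ xs) with a y | x y | ∏-weight xs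
  ... | true | true | ih = begin
    27 * W * (2 * p * q)             ≡⟨ rearr W p q ⟩
    54 * (W * (p * q))               ≡⟨ cong (54 *_) ih ⟩
    54 * (Z * (r * s))               ≡⟨ rearr′ Z r s ⟩
    18 * Z * (3 * r * s)             ∎
    where
    open ≡-Reasoning
    W = ∏ xs w
    Z = 18 ^ length xs
    p = 2 ^ ∑ xs c
    q = 9 ^ ∑ xs e
    r = 3 ^ ∑ xs c
    s = 4 ^ ∑ xs e
    rearr : ∀ W p q → 27 * W * (2 * p * q) ≡ 54 * (W * (p * q))
    rearr = solve-∀
    rearr′ : ∀ W p q → 54 * (W * (p * q)) ≡ 18 * W * (3 * p * q)
    rearr′ = solve-∀
  ... | true | false | ih = begin
    8 * W * (p * (9 * q))            ≡⟨ rearr W p q ⟩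
    72 * (W * (p * q))               ≡⟨ cong (72 *_) ih ⟩
    72 * (Z * (r * s))               ≡⟨ rearr′ Z r s ⟩
    18 * Z * (r * (4 * s))           ∎
    where
    open ≡-Reasoning
    W = ∏ xs w
    Z = 18 ^ length xs
    p = 2 ^ ∑ xs c
    q = 9 ^ ∑ xs e
    r = 3 ^ ∑ xs c
    s = 4 ^ ∑ xs e
    rearr : ∀ W p q → 8 * W * (p * (9 * q)) ≡ 72 * (W * (p * q))
    rearr = solve-∀
    rearr′ : ∀ W p q → 72 * (W * (p * q)) ≡ 18 * W * (p * (4 * q))
    rearr′ = solve-∀
  ... | false | _ | ih =
    trans (*-assoc 18 (∏ xs w) _) (trans (cong (18 *_) ih) (≡-sym (*-assoc 18 (18 ^ length xs) _)))

  -- The pointwise half of Markov's inequality: the product of weights is `18 ^ length xs` times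
  -- `(3/2) ^ (C - 2E)`, and the hypothesis bounds the exponent below by `- L`.
  tail-≤-weight : (xs : List A) (L : ℕ) → 2 * ∑ xs e ≤ ∑ xs c + L →
                  18 ^ length xs * 2 ^ L ≤ ∏ xs w * 3 ^ L
  tail-≤-weight xs L h = *-cancelʳ-≤ _ _ (p * q) {{m*n≢0 p q {{m^n≢0 2 C}} {{m^n≢0 9 E}}}} (begin
    Z * 2 ^ L * (p * q)                  ≡⟨ rearr Z (2 ^ L) p q ⟩
    Z * (p * 2 ^ L * q)                  ≡⟨ cong (λ y → Z * (y * q)) (trans (≡-sym (^-distribˡ-+-* 2 C L)) (cong (2 ^_) (≡-sym t≡))) ⟩
    Z * (2 ^ (2 * E + t) * q)            ≡⟨ cong (λ y → Z * (y * q)) (trans (^-distribˡ-+-* 2 (2 * E) t) (cong (_* 2 ^ t) (≡-sym (^-*-assoc 2 2 E)))) ⟩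
    Z * (s * 2 ^ t * q)                  ≤⟨ *-monoʳ-≤ Z (*-monoˡ-≤ q (*-monoʳ-≤ s (^-monoˡ-≤ t (s≤s (s≤s (z≤n {1})))))) ⟩
    Z * (s * 3 ^ t * q)                  ≡⟨ rearr′ Z s (3 ^ t) q ⟩
    Z * (q * 3 ^ t * s)                  ≡⟨ cong (λ y → Z * (y * s)) (trans (cong (_* 3 ^ t) (^-*-assoc 3 2 E)) (≡-sym (^-distribˡ-+-* 3 (2 * E) t))) ⟩
    Z * (3 ^ (2 * E + t) * s)            ≡⟨ cong (λ y → Z * (y * s)) (trans (cong (3 ^_) t≡) (^-distribˡ-+-* 3 C L)) ⟩
    Z * (r * 3 ^ L * s)                  ≡⟨ rearr″ Z r (3 ^ L) s ⟩
    Z * (r * s) * 3 ^ L                  ≡⟨ cong (_* 3 ^ L) (≡-sym (∏-weight xs)) ⟩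
    ∏ xs w * (p * q) * 3 ^ L             ≡⟨ rearr‴ (∏ xs w) (p * q) (3 ^ L) ⟩
    ∏ xs w * 3 ^ L * (p * q)             ∎)
    where
    open ≤-Reasoning
    C = ∑ xs c
    E = ∑ xs e
    Z = 18 ^ length xs
    p = 2 ^ C
    q = 9 ^ E
    r = 3 ^ C
    s = 4 ^ E
    -- The slack of the hypothesis. The only inequality in the chain is `2 ^ t ≤ 3 ^ t`.
    t = C + L ∸ 2 * E
    t≡ : 2 * E + t ≡ C + L
    t≡ = m+[n∸m]≡n h
    rearr : ∀ Z l p q → Z * l * (p * q) ≡ Z * (p * l * q)
    rearr = solve-∀
    rearr′ : ∀ Z s t q → Z * (s * t * q) ≡ Z * (q * t * s)
    rearr′ = solve-∀
    rearr″ : ∀ Z r l s → Z * (r * l * s) ≡ Z * (r * s) * l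
    rearr″ = solve-∀
    rearr‴ : ∀ W x l → W * x * l ≡ W * l * x
    rearr‴ = solve-∀

  -- Pointwise the weight is 18, plus 9 for a crossing neighbour, minus 10 for one on the same side.
  -- So if there are no more crossing than same-side neighbours, the total falls below
  -- `18 * length xs` by at least the number of the latter.
  ∑-weight : (xs : List A) → ∑ xs w + 10 * ∑ xs e ≡ 18 * length xs + 9 * ∑ xs c
  ∑-weight xs = begin
    ∑ xs w + 10 * ∑ xs e             ≡⟨ cong (∑ xs w +_) (≡-sym (∑-*ˡ xs e 10)) ⟩
    ∑ xs w + ∑ xs (λ y → 10 * e y)   ≡⟨ ≡-sym (∑-+ xs w _) ⟩
    ∑ xs (λ y → w y + 10 * e y)      ≡⟨ ∑-cong xs pointwise ⟩
    ∑ xs (λ y → 18 * 1 + 9 * c y)    ≡⟨ ∑-+ xs _ _ ⟩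
    ∑ xs (λ y → 18 * 1) + ∑ xs (λ y → 9 * c y) ≡⟨ cong₂ _+_ (trans (∑-*ˡ xs (const 1) 18) (cong (18 *_) (≡-sym (length≡∑ xs)))) (∑-*ˡ xs c 9) ⟩
    18 * length xs + 9 * ∑ xs c      ∎
    where
    open ≡-Reasoning
    pointwise : ∀ y → w y + 10 * e y ≡ 18 * 1 + 9 * c y
    pointwise y with a y | x y
    ... | true  | true  = refl
    ... | true  | false = refl
    ... | false | _     = refl

-- With A = 36 N = suc y, a table of A * (2 * g) samples makes the moment
-- (2Q)^m ≤ (k y)^m shrink by the factor (1 - 1/A)^(A * 2g) ≤ 4^(-g).
tail-count : ∀ {bad Q k N g} y → suc y ≡ 36 * N → 2 * Q ≤ k * y →
             bad * (18 ^ (suc y * (2 * g)) * 2 ^ g) ≤ Q ^ (suc y * (2 * g)) * 3 ^ g →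
             bad * 2 ^ g ≤ (k * N) ^ (suc y * (2 * g))
tail-count {bad} {Q} {k} {N} {g} y y≡ hQ h =
  *-cancelʳ-≤ _ _ (36 ^ m * 4 ^ g) {{m*n≢0 (36 ^ m) (4 ^ g) {{m^n≢0 36 m}} {{m^n≢0 4 g}}}} (begin
    bad * 2 ^ g * (36 ^ m * 4 ^ g)             ≡⟨ cong (λ z → bad * 2 ^ g * (z * 4 ^ g)) (^-distribʳ-* m 18 2) ⟩
    bad * 2 ^ g * (18 ^ m * 2 ^ m * 4 ^ g)     ≡⟨ rearr bad (2 ^ g) (18 ^ m) (2 ^ m) (4 ^ g) ⟩
    bad * (18 ^ m * 2 ^ g) * (2 ^ m * 4 ^ g)   ≤⟨ *-monoˡ-≤ (2 ^ m * 4 ^ g) h ⟩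
    Q ^ m * 3 ^ g * (2 ^ m * 4 ^ g)            ≡⟨ rearr′ (Q ^ m) (3 ^ g) (2 ^ m) (4 ^ g) ⟩
    2 ^ m * Q ^ m * 4 ^ g * 3 ^ g              ≡⟨ cong (λ z → z * 4 ^ g * 3 ^ g) (≡-sym (^-distribʳ-* m 2 Q)) ⟩
    (2 * Q) ^ m * 4 ^ g * 3 ^ g                ≤⟨ *-mono-≤ (*-monoˡ-≤ (4 ^ g) (^-monoˡ-≤ m hQ)) (^-monoˡ-≤ g (s≤s (s≤s (s≤s (z≤n {1}))))) ⟩
    (k * y) ^ m * 4 ^ g * 4 ^ g                ≡⟨ cong₂ (λ u v → u * v * 4 ^ g) (^-distribʳ-* m k y) (^-*-assoc 2 2 g) ⟩
    k ^ m * y ^ m * 2 ^ (2 * g) * 4 ^ g        ≡⟨ cong (_* 4 ^ g) (*-assoc (k ^ m) (y ^ m) _) ⟩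
    k ^ m * (y ^ m * 2 ^ (2 * g)) * 4 ^ g      ≤⟨ *-monoˡ-≤ (4 ^ g) (*-monoʳ-≤ (k ^ m) (x^[[1+x]t]*2^t≤ y (2 * g))) ⟩
    k ^ m * suc y ^ m * 4 ^ g                  ≡⟨ cong (λ z → k ^ m * z ^ m * 4 ^ g) y≡ ⟩
    k ^ m * (36 * N) ^ m * 4 ^ g               ≡⟨ cong (λ z → k ^ m * z * 4 ^ g) (^-distribʳ-* m 36 N) ⟩
    k ^ m * (36 ^ m * N ^ m) * 4 ^ g           ≡⟨ rearr″ (k ^ m) (36 ^ m) (N ^ m) (4 ^ g) ⟩
    k ^ m * N ^ m * (36 ^ m * 4 ^ g)           ≡⟨ cong (_* (36 ^ m * 4 ^ g)) (≡-sym (^-distribʳ-* m k N)) ⟩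
    (k * N) ^ m * (36 ^ m * 4 ^ g)             ∎)
  where
  open ≤-Reasoning
  m = suc y * (2 * g)
  rearr : ∀ b x z t f → b * x * (z * t * f) ≡ b * (z * x) * (t * f)
  rearr = solve-∀
  rearr′ : ∀ q x t f → q * x * (t * f) ≡ t * q * f * x
  rearr′ = solve-∀
  rearr″ : ∀ a b c d → a * (b * c) * d ≡ a * c * (b * d)
  rearr″ = solve-∀

-- Elements are greedily collected into groups of total at least D/2; closing a group
-- costs a factor 8, and t records the unused part of D of the group still open.
module _ (D : ℕ) (a p : A → ℕ) (a+p : ∀ x → a x + p x ≡ D) (a≤ : ∀ x → 4 * a x ≤ 3 * D) where
  private
    D≤4p : ∀ x → D ≤ 4 * p x
    D≤4p x = +-cancelʳ-≤ (4 * a x) D (4 * p x) (begin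
      D + 4 * a x       ≤⟨ +-monoʳ-≤ D (a≤ x) ⟩
      D + 3 * D         ≡⟨ cong (4 *_) (≡-sym (a+p x)) ⟩
      4 * (a x + p x)   ≡⟨ trans (*-distribˡ-+ 4 (a x) (p x)) (+-comm (4 * a x) _) ⟩
      4 * p x + 4 * a x ∎)
      where open ≤-Reasoning

  grouping : (xs : List A) → ∃ λ κ → ∃ λ s → ∃ λ t → s + t ≡ D × 2 * s ≤ D ×
             κ * D + 2 * s ≤ 2 * ∑ xs a ×
             D ^ length xs * t ≤ 8 ^ κ * (D * ∏ xs p)
  grouping [] = 0 , 0 , D , refl , z≤n , z≤n , ≤-reflexive (rearr D)
    where
    rearr : ∀ D → 1 * D ≡ 1 * (D * 1)
    rearr = solve-∀
  grouping (x ∷ xs) with grouping xs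
  ... | κ , s , t , s+t , 2s≤D , κ≤ , prod with 2 * (s + a x) ≤? D
  ... | yes le = κ , s + a x , D ∸ (s + a x) , m+[n∸m]≡n s+a≤D , le , κ≤′ , prod′
    where
    open ≤-Reasoning
    s+a≤D : s + a x ≤ D
    s+a≤D = ≤-trans (m≤n*m (s + a x) 2) le
    t′ = D ∸ (s + a x)
    κ≤′ : κ * D + 2 * (s + a x) ≤ 2 * (a x + ∑ xs a)
    κ≤′ = begin
      κ * D + 2 * (s + a x)       ≡⟨ rearr (κ * D) s (a x) ⟩
      κ * D + 2 * s + 2 * a x     ≤⟨ +-monoˡ-≤ (2 * a x) κ≤ ⟩
      2 * ∑ xs a + 2 * a x        ≡⟨ rearr′ (∑ xs a) (a x) ⟩
      2 * (a x + ∑ xs a)          ∎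
      where
      rearr : ∀ k s a → k + 2 * (s + a) ≡ k + 2 * s + 2 * a
      rearr = solve-∀
      rearr′ : ∀ s a → 2 * s + 2 * a ≡ 2 * (a + s)
      rearr′ = solve-∀
    t≡ : t ≡ a x + t′
    t≡ = +-cancelˡ-≡ s _ _ (trans s+t (trans (≡-sym (m+[n∸m]≡n s+a≤D)) (+-assoc s (a x) t′)))
    p≡ : p x ≡ s + t′
    p≡ = +-cancelˡ-≡ (a x) _ _ (trans (a+p x) (trans (≡-sym (m+[n∸m]≡n s+a≤D))
           (trans (cong (_+ t′) (+-comm s (a x))) (+-assoc (a x) s t′))))
    -- In units of `D` this is `(1 - s)(1 - a) ≥ 1 - (s + a)`: an element joins the open group
    -- without loss.
    Dt′≤tp : D * t′ ≤ t * p x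
    Dt′≤tp = begin
      D * t′                    ≡⟨ cong (_* t′) (≡-sym (m+[n∸m]≡n s+a≤D)) ⟩
      (s + a x + t′) * t′       ≤⟨ m≤m+n _ (a x * s) ⟩
      (s + a x + t′) * t′ + a x * s ≡⟨ rearr s (a x) t′ ⟩
      (a x + t′) * (s + t′)     ≡⟨ cong₂ _*_ (≡-sym t≡) (≡-sym p≡) ⟩
      t * p x                   ∎
      where
      rearr : ∀ s a t → (s + a + t) * t + a * s ≡ (a + t) * (s + t)
      rearr = solve-∀
    prod′ : D * D ^ length xs * t′ ≤ 8 ^ κ * (D * (p x * ∏ xs p))
    prod′ = begin
      D * D ^ length xs * t′       ≡⟨ rearr D (D ^ length xs) t′ ⟩
      D ^ length xs * (D * t′)     ≤⟨ *-monoʳ-≤ (D ^ length xs) Dt′≤tp ⟩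
      D ^ length xs * (t * p x)    ≡⟨ ≡-sym (*-assoc (D ^ length xs) t (p x)) ⟩
      D ^ length xs * t * p x      ≤⟨ *-monoˡ-≤ (p x) prod ⟩
      8 ^ κ * (D * ∏ xs p) * p x   ≡⟨ rearr′ (8 ^ κ) D (∏ xs p) (p x) ⟩
      8 ^ κ * (D * (p x * ∏ xs p)) ∎
      where
      rearr : ∀ D z t → D * z * t ≡ z * (D * t)
      rearr = solve-∀
      rearr′ : ∀ e D z p → e * (D * z) * p ≡ e * (D * (p * z))
      rearr′ = solve-∀
  ... | no gt = suc κ , 0 , D , refl , z≤n , κ≤′ , prod′
    where
    open ≤-Reasoning
    κ≤′ : (D + κ * D) + 0 ≤ 2 * (a x + ∑ xs a)
    κ≤′ = begin
      D + κ * D + 0                  ≤⟨ +-monoˡ-≤ 0 (+-monoˡ-≤ (κ * D) (≰⇒≥ gt)) ⟩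
      2 * (s + a x) + κ * D + 0      ≡⟨ rearr s (a x) (κ * D) ⟩
      κ * D + 2 * s + 2 * a x        ≤⟨ +-monoˡ-≤ (2 * a x) κ≤ ⟩
      2 * ∑ xs a + 2 * a x           ≡⟨ rearr′ (∑ xs a) (a x) ⟩
      2 * (a x + ∑ xs a)             ∎
      where
      rearr : ∀ s a k → 2 * (s + a) + k + 0 ≡ k + 2 * s + 2 * a
      rearr = solve-∀
      rearr′ : ∀ s a → 2 * s + 2 * a ≡ 2 * (a + s)
      rearr′ = solve-∀
    D≤2t : D ≤ 2 * t
    D≤2t = +-cancelʳ-≤ (2 * s) D (2 * t) (begin
      D + 2 * s         ≤⟨ +-monoʳ-≤ D 2s≤D ⟩
      D + D             ≡⟨ cong (λ z → z + z) (≡-sym s+t) ⟩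
      s + t + (s + t)   ≡⟨ rearr s t ⟩
      2 * t + 2 * s     ∎)
      where
      rearr : ∀ s t → s + t + (s + t) ≡ 2 * t + 2 * s
      rearr = solve-∀
    prod′ : D * D ^ length xs * D ≤ 8 * 8 ^ κ * (D * (p x * ∏ xs p))
    prod′ = begin
      D * D ^ length xs * D              ≡⟨ rearr D (D ^ length xs) ⟩
      D ^ length xs * (D * D)            ≤⟨ *-monoʳ-≤ (D ^ length xs) (*-mono-≤ D≤2t (D≤4p x)) ⟩
      D ^ length xs * (2 * t * (4 * p x)) ≡⟨ rearr″ (D ^ length xs) t (p x) ⟩
      8 * (D ^ length xs * t) * p x      ≤⟨ *-monoˡ-≤ (p x) (*-monoʳ-≤ 8 prod) ⟩
      8 * (8 ^ κ * (D * ∏ xs p)) * p x   ≡⟨ rearr′ (8 ^ κ) D (∏ xs p) (p x) ⟩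
      8 * 8 ^ κ * (D * (p x * ∏ xs p))   ∎
      where
      rearr : ∀ D z → D * z * D ≡ z * (D * D)
      rearr = solve-∀
      rearr″ : ∀ z t p → z * (2 * t * (4 * p)) ≡ 8 * (z * t) * p
      rearr″ = solve-∀
      rearr′ : ∀ e D z p → 8 * (e * (D * z)) * p ≡ 8 * e * (D * (p * z))
      rearr′ = solve-∀

  ∏-lower : .{{_ : NonZero D}} (xs : List A) (κ : ℕ) → 2 * ∑ xs a ≤ κ * D →
            D ^ length xs ≤ 2 * 8 ^ κ * ∏ xs p
  ∏-lower xs κ h with grouping xs
  ... | κ′ , s , t , s+t , 2s≤D , κ′≤ , prod = *-cancelʳ-≤ _ _ D (begin
    D ^ length xs * D             ≤⟨ *-monoʳ-≤ (D ^ length xs) D≤2t ⟩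
    D ^ length xs * (2 * t)       ≡⟨ rearr (D ^ length xs) t ⟩
    2 * (D ^ length xs * t)       ≤⟨ *-monoʳ-≤ 2 prod ⟩
    2 * (8 ^ κ′ * (D * ∏ xs p))   ≤⟨ *-monoʳ-≤ 2 (*-monoˡ-≤ (D * ∏ xs p) (^-monoʳ-≤ 8 κ′≤κ)) ⟩
    2 * (8 ^ κ * (D * ∏ xs p))    ≡⟨ rearr′ (8 ^ κ) D (∏ xs p) ⟩
    2 * 8 ^ κ * ∏ xs p * D        ∎)
    where
    open ≤-Reasoning
    κ′≤κ : κ′ ≤ κ
    κ′≤κ = *-cancelʳ-≤ κ′ κ D (≤-trans (m≤m+n (κ′ * D) (2 * s)) (≤-trans κ′≤ h))
    D≤2t : D ≤ 2 * t
    D≤2t = +-cancelʳ-≤ (2 * s) D (2 * t) (begin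
      D + 2 * s         ≤⟨ +-monoʳ-≤ D 2s≤D ⟩
      D + D             ≡⟨ cong (λ z → z + z) (≡-sym s+t) ⟩
      s + t + (s + t)   ≡⟨ rearr″ s t ⟩
      2 * t + 2 * s     ∎)
      where
      rearr″ : ∀ s t → s + t + (s + t) ≡ 2 * t + 2 * s
      rearr″ = solve-∀
    rearr : ∀ z t → z * (2 * t) ≡ 2 * (z * t)
    rearr = solve-∀
    rearr′ : ∀ e D z → 2 * (e * (D * z)) ≡ 2 * e * z * D
    rearr′ = solve-∀

𝟙-all : (p : A → Bool) (xs : List A) → 𝟙 (all p xs) ≡ ∏ xs (𝟙 ∘ p)
𝟙-all p []       = refl
𝟙-all p (x ∷ xs) with p x
... | true  = trans (𝟙-all p xs) (≡-sym (+-identityʳ _))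
... | false = refl

all-∈ : (p : A → Bool) {xs : List A} → all p xs ≡ true → ∀ {x} → x ∈ xs → p x ≡ true
all-∈ p {y ∷ xs} e i with p y in eq
all-∈ p {y ∷ xs} e (here refl) | true = eq
all-∈ p {y ∷ xs} e (there i)   | true = all-∈ p e i

-- The union bound, before summation over the random strings.
all-not-or : (p : A → Bool) (xs : List A) → 1 ≤ 𝟙 (all (not ∘ p) xs) + ∑ xs (𝟙 ∘ p)
all-not-or p []       = s≤s z≤n
all-not-or p (x ∷ xs) with p x
... | true  = s≤s z≤n
... | false = all-not-or p xs

𝟙-not : ∀ x → 𝟙 x + 𝟙 (not x) ≡ 1
𝟙-not true  = refl
𝟙-not false = refl

not≡true⇒≡false : ∀ {x} → not x ≡ true → x ≡ false
not≡true⇒≡false {false} _ = refl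

∧≡true : ∀ {x y} → x ∧ y ≡ true → x ≡ true × y ≡ true
∧≡true {true} {true} _ = refl , refl

T⇒≡true : ∀ {x} → T x → x ≡ true
T⇒≡true {true} _ = refl

not-xor⇒≡ : ∀ x y → not (x xor y) ≡ true → x ≡ y
not-xor⇒≡ true  true  _ = refl
not-xor⇒≡ false false _ = refl

true≢false : true ≢ false
true≢false ()

n<2^n : ∀ n → n < 2 ^ n
n<2^n zero    = s≤s z≤n
n<2^n (suc n) = begin-strict
  suc n             <⟨ s≤s (n<2^n n) ⟩
  1 + 2 ^ n         ≤⟨ +-monoˡ-≤ (2 ^ n) (m^n>0 2 n) ⟩
  2 ^ n + 2 ^ n     ≡⟨ cong (2 ^ n +_) (≡-sym (+-identityʳ _)) ⟩
  2 ^ suc n         ∎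
  where open ≤-Reasoning

-- Success probability of one trial

module _ {β : ℕ} where
  block : ∀ {n} → Vec Bool (n * β) → Fin n → Vec Bool β
  block {suc n} x zero    = take β x
  block {suc n} x (suc v) = block (drop β x) v

  ∑-∏-block : ∀ n (h : Fin n → Vec Bool β → ℕ) →
              ∑ (bits (n * β)) (λ x → ∏ (allFin n) (λ v → h v (block x v)))
                ≡ ∏ (allFin n) (λ v → ∑ (bits β) (h v))
  ∑-∏-block zero    h = refl
  ∑-∏-block (suc n) h = trans
    (∑-cong (bits (suc n * β)) (λ x → ∏-allFin-suc n (λ v → h v (block x v))))
    (trans (∑-bits-* β (n * β) (h zero) (λ y → ∏ (allFin n) (λ v → h (suc v) (block y v))))
    (trans (cong (∑ (bits β) (h zero) *_) (∑-∏-block n (h ∘ suc)))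
           (≡-sym (∏-allFin-suc n (λ v → ∑ (bits β) (h v))))))

module _ {n : ℕ} (G : Graph n) (S : VSet n) where
  crossing same : Fin n → Fin n → ℕ
  crossing v u = 𝟙 (adj G v u ∧ (S u xor S v))
  same     v u = 𝟙 (adj G v u ∧ not (S u xor S v))

  crossing+same : ∀ v u → crossing v u + same v u ≡ 𝟙 (adj G v u)
  crossing+same v u with adj G v u | S u xor S v
  ... | true  | true  = refl
  ... | true  | false = refl
  ... | false | _     = refl

-- Chosen so that `2 ^ gap b` is four times `2 ^ b`: a bad event of probability `1 / 2 ^ gap b` at
-- each of at most `2 ^ b` vertices has total probability at most 1/4.
gap : ℕ → ℕ
gap b = 2 + b

-- One draw multiplies the normalised moment by at most `1 - 1/(36 N)`, so a batch of `36 * N` draws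
-- halves it. The `2 * gap b` batches yield `4 ^ (- gap b)`, enough to absorb the loss
-- `(3/2) ^ gap b` from the slack in `tail-≤-weight`.
sampleCount : ℕ → ℕ → ℕ
sampleCount b N = 36 * N * (2 * gap b)

-- Large enough that the range of a choice is at least 16 times the length of the table, which keeps
-- the bias of `pick` within a factor 17/16; see `m*16≤D`.
choiceBits : ℕ → ℕ
choiceBits b = 12 + 2 * b

trialBits : ℕ → ℕ → ℕ → ℕ
trialBits n b N = sampleCount b N * b + n * choiceBits b

module _ {n : ℕ} (b N : ℕ) where
  centers : Vec Bool (sampleCount b N * b) → List (Fin n)
  centers x = catMaybes (samples (sampleCount b N) x)

  -- The choice bits are indexed by the vertex and not by its time of arrival, so a label depends
  -- only on the random string, the vertex and its row: the adversarial order has no influence on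
  -- it.
  label : Fin n → Vec Bool (trialBits n b N) → Fin n → (Fin n → Bool) → Fin n
  label z r v row = pick z (filterᵇ row (centers (take (sampleCount b N * b) r)))
    (value (block (drop (sampleCount b N * b) r) v))

  keeps : Graph n → VSet n → Fin n → Vec Bool (trialBits n b N) → Bool
  keeps G S z r = all (λ v → not (S (label z r v (adj G v)) xor S v)) (allFin n)

module Trial {n : ℕ} (κ : ℕ) (κ≥ : 9216 ≤ κ) (b k N : ℕ) (G : Graph n) (S : VSet n) (z : Fin n)
  (n≤ : n ≤ 2 ^ b) (k*N : k * N ≡ 2 ^ b)
  (crossing≤same : ∀ v → ∑ (allFin n) (crossing G S v) ≤ ∑ (allFin n) (same G S v))
  (k≤same : ∀ v → k ≤ 2 * ∑ (allFin n) (same G S v))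
  (crossing≤ : ∑ (allFin n) (λ v → ∑ (allFin n) (crossing G S v)) ≤ 4 * k) where

  private
    V = allFin n
    g = gap b
    m = sampleCount b N
    β = choiceBits b
    D = 2 ^ β
    X = 2 ^ (m * b)

    cr sm : Vec Bool (m * b) → Fin n → ℕ
    cr x v = ∑ (centers {n} b N x) (crossing G S v)
    sm x v = ∑ (centers {n} b N x) (same G S v)

    -- The complement gives two things: `c < 2 * e`, so that at most two thirds of the neighbours in
    -- the table cross, and `g < 2 * e`, so that the table contains more than `g / 2` neighbours.
    low : Vec Bool (m * b) → Fin n → Bool
    low x v = 2 * sm x v ≤ᵇ cr x v + g

    -- 288 * g bounds the expectation; the factor 4 is for Markov's inequality.
    many : Vec Bool (m * b) → Bool
    many x = 1152 * g ≤ᵇ ∑ V (cr x)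

    instance
      N≢0 : NonZero N
      N≢0 = m*n≢0⇒n≢0 k {{subst NonZero (≡-sym k*N) (m^n≢0 2 b)}}
      k≢0 : NonZero k
      k≢0 = m*n≢0⇒m≢0 k {{subst NonZero (≡-sym k*N) (m^n≢0 2 b)}}
      D≢0 : NonZero D
      D≢0 = m^n≢0 2 β
      X≢0 : NonZero (2 ^ b)
      X≢0 = m^n≢0 2 b

  -- Markov's inequality for the product of weights over the table. Empty draws and non-neighbours
  -- have the neutral weight 18.
  low-count : ∀ v → ∑ (bits (m * b)) (λ x → 𝟙 (low x v)) * 2 ^ g ≤ X
  low-count v = ≤-trans
    (tail-count {bad = ∑ (bits (m * b)) (λ x → 𝟙 (low x v))} {Q = Q} {k = k} {N = N} {g = g} y y≡ 2Q≤ bad≤)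
    (≤-reflexive (trans (cong₂ _^_ k*N (cong (_* (2 * g)) y≡)) (trans (^-*-assoc 2 b m) (cong (2 ^_) (*-comm b m)))))
    where
    y = pred (36 * N)
    y≡ = suc-pred (36 * N) {{m*n≢0 36 N}}
    a x : Maybe (Fin n) → Bool
    a = maybe′ (adj G v) false
    x = maybe′ (λ u → S u xor S v) false
    w : Maybe (Fin n) → ℕ
    w s = weight (a s) (x s)
    Q = ∑ (bits b) (w ∘ sample)
    C = ∑ V (crossing G S v)
    E = ∑ V (same G S v)
    open ≤-Reasoning
    -- Since `C ≤ E`, the gain `9 * C` is covered by `9 * E`, and one `E` of the loss `10 * E`
    -- remains.
    Q+E≤ : Q + E ≤ 18 * 2 ^ b
    Q+E≤ = +-cancelʳ-≤ (18 * n + 9 * E) _ _ (begin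
      Q + E + (18 * n + 9 * E)           ≡⟨ rearr Q E n ⟩
      Q + n * 18 + 10 * E                ≡⟨ cong (_+ 10 * E) (∑-sample {b = b} n≤ w) ⟩
      W + 2 ^ b * 18 + 10 * E            ≡⟨ rearr′ W (2 ^ b) E ⟩
      W + 10 * E + 18 * 2 ^ b            ≡⟨ cong (_+ 18 * 2 ^ b) (∑-weight (adj G v) (λ u → S u xor S v) V) ⟩
      18 * length V + 9 * C + 18 * 2 ^ b ≤⟨ +-monoˡ-≤ (18 * 2 ^ b) (+-mono-≤ (≤-reflexive (cong (18 *_) (List.length-tabulate {n = n} id))) (*-monoʳ-≤ 9 (crossing≤same v))) ⟩
      18 * n + 9 * E + 18 * 2 ^ b        ≡⟨ +-comm (18 * n + 9 * E) _ ⟩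
      18 * 2 ^ b + (18 * n + 9 * E)      ∎)
      where
      W = ∑ V (w ∘ just)
      rearr : ∀ Q E n → Q + E + (18 * n + 9 * E) ≡ Q + n * 18 + 10 * E
      rearr = solve-∀
      rearr′ : ∀ W X E → W + X * 18 + 10 * E ≡ W + 10 * E + 18 * X
      rearr′ = solve-∀
    -- The loss `E`, at least `k / 2`, out of `18 * 2 ^ b = 18 * (k * N)` is a fraction of at least
    -- `1/(36 N)`; this is the origin of 36.
    2Q≤ : 2 * Q ≤ k * y
    2Q≤ = +-cancelʳ-≤ k _ _ (begin
      2 * Q + k           ≤⟨ +-monoʳ-≤ (2 * Q) (k≤same v) ⟩
      2 * Q + 2 * E       ≡⟨ *-distribˡ-+ 2 Q E ⟨
      2 * (Q + E)         ≤⟨ *-monoʳ-≤ 2 Q+E≤ ⟩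
      2 * (18 * 2 ^ b)    ≡⟨ cong (λ z → 2 * (18 * z)) (≡-sym k*N) ⟩
      2 * (18 * (k * N))  ≡⟨ rearr k N ⟩
      k * (36 * N)        ≡⟨ cong (k *_) (≡-sym y≡) ⟩
      k * suc y           ≡⟨ rearr′ k y ⟩
      k * y + k           ∎)
      where
      rearr : ∀ k N → 2 * (18 * (k * N)) ≡ k * (36 * N)
      rearr = solve-∀
      rearr′ : ∀ k y → k * (1 + y) ≡ k * y + k
      rearr′ = solve-∀
    maybe-crossing : ∀ s → maybe′ (crossing G S v) 0 s ≡ 𝟙 (a s ∧ x s)
    maybe-crossing (just u) = refl
    maybe-crossing nothing  = refl
    maybe-same : ∀ s → maybe′ (same G S v) 0 s ≡ 𝟙 (a s ∧ not (x s))
    maybe-same (just u) = refl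
    maybe-same nothing  = refl
    pointwise : ∀ t → 𝟙 (low t v) * (18 ^ m * 2 ^ g) ≤ ∏ (samples m t) w * 3 ^ g
    pointwise t with low t v | ≤ᵇ⇒≤ (2 * sm t v) (cr t v + g)
    ... | false | _  = z≤n
    ... | true  | le = begin
      1 * (18 ^ m * 2 ^ g)    ≡⟨ *-identityˡ _ ⟩
      18 ^ m * 2 ^ g          ≡⟨ cong (λ l → 18 ^ l * 2 ^ g) (≡-sym (length-samples m t)) ⟩
      18 ^ length (samples m t) * 2 ^ g ≤⟨ tail-≤-weight a x (samples m t) g (subst₂ (λ e c → 2 * e ≤ c + g)
        (trans (∑-catMaybes (samples m t) _) (∑-cong (samples m t) maybe-same))
        (trans (∑-catMaybes (samples m t) _) (∑-cong (samples m t) maybe-crossing)) (le _)) ⟩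
      ∏ (samples m t) w * 3 ^ g ∎
    bad≤ : ∑ (bits (m * b)) (λ t → 𝟙 (low t v)) * (18 ^ (suc y * (2 * g)) * 2 ^ g) ≤ Q ^ (suc y * (2 * g)) * 3 ^ g
    bad≤ = subst (λ l → ∑ (bits (m * b)) (λ t → 𝟙 (low t v)) * (18 ^ (l * (2 * g)) * 2 ^ g) ≤ Q ^ (l * (2 * g)) * 3 ^ g) (≡-sym y≡) (begin
      ∑ (bits (m * b)) (λ t → 𝟙 (low t v)) * (18 ^ m * 2 ^ g)   ≡⟨ ≡-sym (∑-*ʳ (bits (m * b)) _ _) ⟩
      ∑ (bits (m * b)) (λ t → 𝟙 (low t v) * (18 ^ m * 2 ^ g))   ≤⟨ ∑-mono (bits (m * b)) pointwise ⟩
      ∑ (bits (m * b)) (λ t → ∏ (samples m t) w * 3 ^ g)        ≡⟨ ∑-*ʳ (bits (m * b)) _ _ ⟩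
      ∑ (bits (m * b)) (λ t → ∏ (samples m t) w) * 3 ^ g        ≡⟨ cong (_* 3 ^ g) (∑-∏-samples m w) ⟩
      Q ^ m * 3 ^ g                                             ∎)

  many-count : ∑ (bits (m * b)) (𝟙 ∘ many) * 4 ≤ X
  many-count = *-cancelʳ-≤ _ _ (288 * g) (begin
    M * 4 * (288 * g)                          ≡⟨ rearr M g ⟩
    M * (1152 * g)                             ≤⟨ markov (bits (m * b)) (λ x → ∑ V (cr x)) (1152 * g) ⟩
    ∑ (bits (m * b)) (λ x → ∑ V (cr x))        ≡⟨ ∑-cong (bits (m * b)) (λ x → trans (∑-swap V (centers b N x) (crossing G S))
                                                    (∑-catMaybes (samples m x) h)) ⟩
    ∑ (bits (m * b)) (λ x → ∑ (samples m x) h′) ≤⟨ *-cancelʳ-≤ _ _ (2 ^ b) bound ⟩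
    X * (288 * g)                              ∎)
    where
    open ≤-Reasoning
    M = ∑ (bits (m * b)) (𝟙 ∘ many)
    h : Fin n → ℕ
    h u = ∑ V (λ v → crossing G S v u)
    h′ = maybe′ h 0
    rearr : ∀ M g → M * 4 * (288 * g) ≡ M * (1152 * g)
    rearr = solve-∀
    ∑h : ∑ (bits b) (h′ ∘ sample) ≤ 4 * k
    ∑h = begin
      ∑ (bits b) (h′ ∘ sample)         ≤⟨ m≤m+n _ (n * 0) ⟩
      ∑ (bits b) (h′ ∘ sample) + n * 0 ≡⟨ ∑-sample {b = b} n≤ h′ ⟩
      ∑ V h + 2 ^ b * 0                ≡⟨ trans (cong (∑ V h +_) (*-zeroʳ (2 ^ b))) (+-identityʳ _) ⟩
      ∑ V h                            ≡⟨ ∑-swap V V _ ⟩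
      ∑ V (λ v → ∑ V (crossing G S v)) ≤⟨ crossing≤ ⟩
      4 * k                            ∎
    bound : ∑ (bits (m * b)) (λ x → ∑ (samples m x) h′) * 2 ^ b ≤ X * (288 * g) * 2 ^ b
    bound = begin
      ∑ (bits (m * b)) (λ x → ∑ (samples m x) h′) * 2 ^ b ≡⟨ ∑-∑-samples m h′ ⟩
      m * ∑ (bits b) (h′ ∘ sample) * X       ≤⟨ *-monoˡ-≤ X (*-monoʳ-≤ m ∑h) ⟩
      m * (4 * k) * X                        ≡⟨ rearr′ N g k X ⟩
      X * (288 * g) * (k * N)                ≡⟨ cong (X * (288 * g) *_) k*N ⟩
      X * (288 * g) * 2 ^ b                  ∎
      where
      rearr′ : ∀ N g k X → 36 * N * (2 * g) * (4 * k) * X ≡ X * (288 * g) * (k * N)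
      rearr′ = solve-∀

  private
    good : Vec Bool (m * b) → Bool
    good x = not (many x) ∧ all (not ∘ low x) V

  -- Each bad event takes at most a quarter of the tables: `many` by Markov's inequality, `low` by
  -- the union bound over the vertices.
  good-count : X ≤ 2 * ∑ (bits (m * b)) (𝟙 ∘ good)
  good-count = *-cancelˡ-≤ 2 (+-cancelʳ-≤ (X + X) _ _ (begin
    2 * X + (X + X)          ≡⟨ rearr X ⟩
    4 * X                    ≡⟨ cong (4 *_) (trans (≡-sym (*-identityʳ X)) (≡-sym (∑-bits-const (m * b) 1))) ⟩
    4 * ∑ Bs (const 1)       ≤⟨ *-monoʳ-≤ 4 (∑-mono Bs cover) ⟩
    4 * ∑ Bs (λ x → 𝟙 (good x) + (𝟙 (many x) + ∑ V (λ v → 𝟙 (low x v))))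
                             ≡⟨ cong (4 *_) (trans (∑-+ Bs (𝟙 ∘ good) _) (cong (∑ Bs (𝟙 ∘ good) +_) (trans (∑-+ Bs (𝟙 ∘ many) _)
                                  (cong (∑ Bs (𝟙 ∘ many) +_) (∑-swap Bs V (λ x v → 𝟙 (low x v))))))) ⟩
    4 * (#g + (#m + #l))     ≡⟨ rearr′ #g #m #l ⟩
    2 * (2 * #g) + (#m * 4 + #l * 4) ≤⟨ +-monoʳ-≤ (2 * (2 * #g)) (+-mono-≤ many-count low≤) ⟩
    2 * (2 * #g) + (X + X)   ∎))
    where
    open ≤-Reasoning
    Bs = bits (m * b)
    #g = ∑ Bs (𝟙 ∘ good)
    #m = ∑ Bs (𝟙 ∘ many)
    #l = ∑ V (λ v → ∑ Bs (λ x → 𝟙 (low x v)))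
    rearr : ∀ X → 2 * X + (X + X) ≡ 4 * X
    rearr = solve-∀
    rearr′ : ∀ a b c → 4 * (a + (b + c)) ≡ 2 * (2 * a) + (b * 4 + c * 4)
    rearr′ = solve-∀
    cover : ∀ x → 1 ≤ 𝟙 (good x) + (𝟙 (many x) + ∑ V (λ v → 𝟙 (low x v)))
    cover x with many x
    ... | true  = s≤s z≤n
    ... | false = all-not-or (low x) V
    low≤ : #l * 4 ≤ X
    low≤ = *-cancelʳ-≤ _ _ (2 ^ b) (begin
      #l * 4 * 2 ^ b           ≡⟨ trans (*-assoc #l 4 _) (cong (#l *_) (≡-sym (^-distribˡ-+-* 2 2 b))) ⟩
      #l * 2 ^ g               ≡⟨ ≡-sym (∑-*ʳ V _ (2 ^ g)) ⟩
      ∑ V (λ v → ∑ Bs (λ x → 𝟙 (low x v)) * 2 ^ g) ≤⟨ ∑-mono V low-count ⟩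
      ∑ V (const X)            ≡⟨ trans (∑-const V X) (cong (_* X) (List.length-tabulate {n = n} id)) ⟩
      n * X                    ≤⟨ *-monoˡ-≤ X n≤ ⟩
      2 ^ b * X                ≡⟨ *-comm (2 ^ b) X ⟩
      X * 2 ^ b                ∎)

  m*16≤D : m * 16 ≤ D
  m*16≤D = begin
    36 * N * (2 * g) * 16      ≤⟨ *-monoˡ-≤ 16 (*-mono-≤ (*-monoʳ-≤ 36 N≤) (*-monoʳ-≤ 2 g≤)) ⟩
    36 * Y * (2 * (2 * Y)) * 16 ≡⟨ rearr Y ⟩
    2304 * (Y * Y)             ≤⟨ *-monoˡ-≤ (Y * Y) (m≤m+n 2304 1792) ⟩
    4096 * (Y * Y)             ≡⟨ cong (4096 *_) (trans (≡-sym (^-distribˡ-+-* 2 b b)) (cong (λ l → 2 ^ (b + l)) (≡-sym (+-identityʳ b)))) ⟩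
    4096 * 2 ^ (2 * b)         ≡⟨ ≡-sym (^-distribˡ-+-* 2 12 (2 * b)) ⟩
    D                          ∎
    where
    open ≤-Reasoning
    Y = 2 ^ b
    N≤ : N ≤ Y
    N≤ = subst (N ≤_) k*N (m≤n*m N k)
    g≤ : g ≤ 2 * Y
    g≤ = begin
      1 + suc b                ≤⟨ +-mono-≤ (m^n>0 2 b) (n<2^n b) ⟩
      Y + Y                    ≡⟨ cong (Y +_) (≡-sym (+-identityʳ Y)) ⟩
      2 * Y                    ∎
    rearr : ∀ Y → 36 * Y * (2 * (2 * Y)) * 16 ≡ 2304 * (Y * Y)
    rearr = solve-∀

  module _ (x : Vec Bool (m * b)) (gd : good x ≡ true) where
    private
      R = centers {n} b N x

      pk : Fin n → Vec Bool β → Fin n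
      pk v ρ = pick z (filterᵇ (adj G v) R) (value ρ)

      a p : Fin n → ℕ
      a v = ∑ (bits β) (λ ρ → 𝟙 (S (pk v ρ) xor S v))
      p v = ∑ (bits β) (λ ρ → 𝟙 (not (S (pk v ρ) xor S v)))

      a+p : ∀ v → a v + p v ≡ D
      a+p v = trans (≡-sym (∑-+ (bits β) _ _)) (trans (∑-cong (bits β) (λ ρ → 𝟙-not (S (pk v ρ) xor S v)))
                (trans (∑-bits-const β 1) (*-identityʳ D)))

      few : ∑ V (cr x) ≤ 1152 * g
      few = <⇒≤ (≰⇒> (λ le → true≢false (trans (≡-sym (T⇒≡true (≤⇒≤ᵇ le)))
        (not≡true⇒≡false (proj₁ (∧≡true gd))))))

      high : ∀ v → cr x v + g < 2 * sm x v
      high v = ≰⇒> (λ le → true≢false (trans (≡-sym (T⇒≡true (≤⇒≤ᵇ le)))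
        (not≡true⇒≡false (all-∈ (not ∘ low x) (proj₂ (∧≡true gd)) (Mem.∈-allFin v)))))

      module _ (v : Fin n) where
        c e d : ℕ
        c = cr x v
        e = sm x v
        d = length (filterᵇ (adj G v) R)

        d≡ : d ≡ c + e
        d≡ = trans (length-filter≡∑ R (adj G v)) (trans (∑-cong R (λ u → ≡-sym (crossing+same G S v u))) (∑-+ R _ _))

        0<e : 0 < e
        0<e with e | high v
        ... | suc _ | _ = s≤s z≤n

        0<d : 0 < d
        0<d = subst (0 <_) (≡-sym d≡) (≤-trans 0<e (m≤n+m e c))

        d*16≤D : d * 16 ≤ D
        d*16≤D = ≤-trans (*-monoˡ-≤ 16 (≤-trans (List.length-filter _ R)
          (≤-trans (length-catMaybes-≤ (samples m x)) (≤-reflexive (length-samples m x))))) m*16≤D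

        a*d≤ : a v * d ≤ (D + d) * c
        a*d≤ = begin
          a v * d                  ≡⟨ cong (_* d) (∑-value β (λ i → 𝟙 (S (pick z (filterᵇ (adj G v) R) i) xor S v))) ⟩
          ∑< D ((λ u → 𝟙 (S u xor S v)) ∘ pick z (filterᵇ (adj G v) R)) * d ≤⟨ ∑<-pick z (filterᵇ (adj G v) R) D _ 0<d ⟩
          (D + d) * ∑ (filterᵇ (adj G v) R) (λ u → 𝟙 (S u xor S v)) ≡⟨ cong ((D + d) *_) (trans (∑-filter R (adj G v) _) (∑-cong R if-∧)) ⟩
          (D + d) * c              ∎
          where
          open ≤-Reasoning
          if-∧ : ∀ u → (if adj G v u then 𝟙 (S u xor S v) else 0) ≡ crossing G S v u
          if-∧ u with adj G v u
          ... | true  = refl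
          ... | false = refl

        16ad≤ : 16 * (a v * d) ≤ 17 * (D * c)
        16ad≤ = begin
          16 * (a v * d)           ≤⟨ *-monoʳ-≤ 16 a*d≤ ⟩
          16 * ((D + d) * c)       ≡⟨ rearr D d c ⟩
          (16 * D + d * 16) * c    ≤⟨ *-monoˡ-≤ c (+-monoʳ-≤ (16 * D) d*16≤D) ⟩
          (16 * D + D) * c         ≡⟨ rearr′ D c ⟩
          17 * (D * c)             ∎
          where
          open ≤-Reasoning
          rearr : ∀ D d c → 16 * ((D + d) * c) ≡ (16 * D + d * 16) * c
          rearr = solve-∀
          rearr′ : ∀ D c → (16 * D + D) * c ≡ 17 * (D * c)
          rearr′ = solve-∀

        3c≤2d : 3 * c ≤ 2 * d
        3c≤2d = begin
          3 * c                  ≡⟨ +-comm c (2 * c) ⟩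
          2 * c + c              ≤⟨ +-monoʳ-≤ (2 * c) (≤-trans (m≤m+n c g) (<⇒≤ (high v))) ⟩
          2 * c + 2 * e          ≡⟨ ≡-sym (*-distribˡ-+ 2 c e) ⟩
          2 * (c + e)            ≡⟨ cong (2 *_) (≡-sym d≡) ⟩
          2 * d                  ∎
          where open ≤-Reasoning

        -- The failure probability is at most `17/16 * c/d`, and `c/d` is at most 2/3; the product
        -- 17/24 is rounded up to 3/4.
        a≤ : 4 * a v ≤ 3 * D
        a≤ = *-cancelʳ-≤ _ _ (12 * d) {{m*n≢0 12 d {{_}} {{>-nonZero 0<d}}}} (begin
          4 * a v * (12 * d)     ≡⟨ rearr (a v) d ⟩
          3 * (16 * (a v * d))   ≤⟨ *-monoʳ-≤ 3 16ad≤ ⟩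
          3 * (17 * (D * c))     ≡⟨ rearr′ D c ⟩
          17 * D * (3 * c)       ≤⟨ *-mono-≤ (*-monoˡ-≤ D (m≤m+n 17 1)) 3c≤2d ⟩
          18 * D * (2 * d)       ≡⟨ rearr″ D d ⟩
          3 * D * (12 * d)       ∎)
          where
          open ≤-Reasoning
          rearr : ∀ a d → 4 * a * (12 * d) ≡ 3 * (16 * (a * d))
          rearr = solve-∀
          rearr′ : ∀ D c → 3 * (17 * (D * c)) ≡ 17 * D * (3 * c)
          rearr′ = solve-∀
          rearr″ : ∀ D d → 18 * D * (2 * d) ≡ 3 * D * (12 * d)
          rearr″ = solve-∀

        -- Here `d` is bounded below through `g < 2 * e ≤ 2 * d`, so the failure probability is at
        -- most a constant times `c / g`, a bound that can be summed over `v`.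
        a*g≤ : a v * g ≤ c * (4 * D)
        a*g≤ = *-cancelˡ-≤ 8 (begin
          8 * (a v * g)          ≤⟨ *-monoʳ-≤ 8 (*-monoʳ-≤ (a v) (≤-trans (m≤n+m g c) (<⇒≤ (high v)))) ⟩
          8 * (a v * (2 * e))    ≤⟨ *-monoʳ-≤ 8 (*-monoʳ-≤ (a v) (*-monoʳ-≤ 2 (subst (e ≤_) (≡-sym d≡) (m≤n+m e c)))) ⟩
          8 * (a v * (2 * d))    ≡⟨ rearr (a v) d ⟩
          16 * (a v * d)         ≤⟨ 16ad≤ ⟩
          17 * (D * c)           ≤⟨ *-monoˡ-≤ (D * c) (m≤m+n 17 15) ⟩
          32 * (D * c)           ≡⟨ rearr′ D c ⟩
          8 * (c * (4 * D))      ∎)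
          where
          open ≤-Reasoning
          rearr : ∀ a d → 8 * (a * (2 * d)) ≡ 16 * (a * d)
          rearr = solve-∀
          rearr′ : ∀ D c → 32 * (D * c) ≡ 8 * (c * (4 * D))
          rearr′ = solve-∀

      -- The bound `few` on the crossing pairs grows like `g`, which cancels. The constant 9216 is
      -- `2 * 1152 * 4`, independent of `n`.
      ∑a≤ : 2 * ∑ V a ≤ 9216 * D
      ∑a≤ = *-cancelʳ-≤ _ _ g (begin
        2 * ∑ V a * g                ≡⟨ *-assoc 2 (∑ V a) g ⟩
        2 * (∑ V a * g)              ≡⟨ cong (2 *_) (≡-sym (∑-*ʳ V a g)) ⟩
        2 * ∑ V (λ v → a v * g)      ≤⟨ *-monoʳ-≤ 2 (∑-mono V a*g≤) ⟩
        2 * ∑ V (λ v → cr x v * (4 * D)) ≡⟨ cong (2 *_) (∑-*ʳ V (cr x) (4 * D)) ⟩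
        2 * (∑ V (cr x) * (4 * D))   ≤⟨ *-monoʳ-≤ 2 (*-monoˡ-≤ (4 * D) few) ⟩
        2 * (1152 * g * (4 * D))     ≡⟨ rearr g D ⟩
        9216 * D * g                 ∎)
        where
        open ≤-Reasoning
        rearr : ∀ g D → 2 * (1152 * g * (4 * D)) ≡ 9216 * D * g
        rearr = solve-∀

    -- For a fixed good table the vertices choose with disjoint blocks of bits, so the count of
    -- strings with all labels right is a product over the vertices.
    choice-count : 2 ^ (n * β) ≤ 2 * 8 ^ κ *
      ∑ (bits (n * β)) (λ ρ → 𝟙 (all (λ v → not (S (pk v (block ρ v)) xor S v)) V))
    choice-count = subst₂ (λ l r → l ≤ 2 * 8 ^ κ * r)
      (trans (cong (D ^_) (List.length-tabulate {n = n} id)) (trans (^-*-assoc 2 β n) (cong (2 ^_) (*-comm β n))))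
      (trans (≡-sym (∑-∏-block n (λ v ρ → 𝟙 (not (S (pk v ρ) xor S v)))))
        (∑-cong (bits (n * β)) (λ ρ → ≡-sym (𝟙-all (λ v → not (S (pk v (block ρ v)) xor S v)) V))))
      (∏-lower D a p a+p a≤ V κ (≤-trans ∑a≤ (*-monoˡ-≤ D κ≥)))

  keeps-count : 2 ^ trialBits n b N ≤ 4 * 8 ^ κ * ∑ (bits (trialBits n b N)) (𝟙 ∘ keeps b N G S z)
  keeps-count = begin
    2 ^ (m * b + n * β)              ≡⟨ ^-distribˡ-+-* 2 (m * b) (n * β) ⟩
    X * Z                            ≤⟨ *-monoˡ-≤ Z good-count ⟩
    2 * #g * Z                       ≡⟨ *-assoc 2 #g Z ⟩
    2 * (#g * Z)                     ≡⟨ cong (2 *_) (≡-sym (∑-*ʳ (bits (m * b)) _ Z)) ⟩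
    2 * ∑ (bits (m * b)) (λ x → 𝟙 (good x) * Z) ≤⟨ *-monoʳ-≤ 2 (∑-mono (bits (m * b)) pointwise) ⟩
    2 * ∑ (bits (m * b)) (λ x → 2 * P * F x)   ≡⟨ cong (2 *_) (∑-*ˡ (bits (m * b)) F (2 * P)) ⟩
    2 * (2 * P * ∑ (bits (m * b)) F) ≡⟨ rearr P (∑ (bits (m * b)) F) ⟩
    4 * P * ∑ (bits (m * b)) F       ≡⟨ cong (4 * P *_) (≡-sym (∑-bits-+ (m * b) (n * β) f)) ⟩
    4 * P * ∑ (bits (trialBits n b N)) (𝟙 ∘ keeps b N G S z) ∎
    where
    open ≤-Reasoning
    P = 8 ^ κ
    Z = 2 ^ (n * β)
    #g = ∑ (bits (m * b)) (𝟙 ∘ good)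
    f : Vec Bool (m * b) → Vec Bool (n * β) → ℕ
    f x ρ = 𝟙 (all (λ v → not (S (pick z (filterᵇ (adj G v) (centers b N x)) (value (block ρ v))) xor S v)) V)
    F : Vec Bool (m * b) → ℕ
    F x = ∑ (bits (n * β)) (f x)
    rearr : ∀ P f → 2 * (2 * P * f) ≡ 4 * P * f
    rearr = solve-∀
    pointwise : ∀ x → 𝟙 (good x) * Z ≤ 2 * P * F x
    pointwise x with good x in eq
    ... | false = z≤n
    ... | true  = ≤-trans (≤-reflexive (*-identityˡ Z)) (choice-count x eq)

-- Cuts and their certificates

any-true : (p : A → Bool) (xs : List A) → any p xs ≡ true → ∃ λ x → x ∈ xs × p x ≡ true
any-true p (x ∷ xs) e with p x in eq
... | true  = x , here refl , eq
... | false with any-true p xs e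
...   | y , i , q = y , there i , q

any-false : (p : A → Bool) {xs : List A} → any p xs ≡ false → ∀ {x} → x ∈ xs → p x ≡ false
any-false p {y ∷ xs} e i with p y in eq
any-false p {y ∷ xs} e (here refl) | false = eq
any-false p {y ∷ xs} e (there i)   | false = any-false p e i

any-∈ : (p : A → Bool) {xs : List A} {x : A} → x ∈ xs → p x ≡ true → any p xs ≡ true
any-∈ p {xs} i e with any p xs in eq
... | true  = refl
... | false = ⊥-elim (true≢false (trans (≡-sym e) (any-false p eq i)))

module _ {n : ℕ} where
  Edge : Set
  Edge = Fin n × Fin n

  separates : VSet n → Edge → Bool
  separates S (x , y) = S y xor S x

  load : List Edge → VSet n → ℕ
  load H S = ∑ H (λ e → 𝟙 (separates S e))

  load-cong : ∀ H {S S′ : VSet n} → (∀ v → S v ≡ S′ v) → load H S ≡ load H S′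
  load-cong H h = ∑-cong H (λ (x , y) → cong₂ (λ a b → 𝟙 (b xor a)) (h x) (h y))

  -- An edge is worth storing if some cut that separates it still has fewer than `K` stored edges.
  -- Every vertex set is tried.
  splittable : ℕ → List Edge → Edge → Bool
  splittable K H e = any (λ t → separates (lookup t) e ∧ (load H (lookup t) <ᵇ K)) (bits n)

  addEdge : ℕ → Edge → List Edge → List Edge
  addEdge K e H = if splittable K H e then e ∷ H else H

  certificate : ℕ → List Edge → List Edge
  certificate K = foldr (addEdge K) []

  load-certificate-≤ : ∀ K es S → load (certificate K es) S ≤ load es S
  load-certificate-≤ K []       S = z≤n
  load-certificate-≤ K (e ∷ es) S with splittable K (certificate K es) e
  ... | true  = +-monoʳ-≤ _ (load-certificate-≤ K es S)
  ... | false = ≤-trans (load-certificate-≤ K es S) (m≤n+m _ _)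

  -- A discarded edge separated by `S` would contradict its rejection, as `S` itself has fewer than
  -- `K` stored edges. The hypothesis is on the certificate and not on `es`, so exactness of a cut
  -- can be recognised from the stored edges alone.
  load-certificate-≡ : ∀ K es S → load (certificate K es) S < K → load (certificate K es) S ≡ load es S
  load-certificate-≡ K []       S l = refl
  load-certificate-≡ K (e ∷ es) S l with splittable K (certificate K es) e in eq
  ... | true  = cong (𝟙 (separates S e) +_) (load-certificate-≡ K es S (≤-<-trans (m≤n+m _ _) l))
  ... | false = trans (load-certificate-≡ K es S l) (cong (λ b → 𝟙 b + load es S) (≡-sym unseparated))
    where
    t = Vec.tabulate S
    agree : ∀ v → lookup t v ≡ S v
    agree = Vec.lookup∘tabulate S
    H = certificate K es
    small : (load H (lookup t) <ᵇ K) ≡ true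
    small = T⇒≡true (<⇒<ᵇ (subst (_< K) (≡-sym (load-cong H agree)) l))
    unseparated : separates S e ≡ false
    unseparated with any-false _ eq (∈-bits t)
    ... | q rewrite small | agree (proj₁ e) | agree (proj₂ e) with separates S e
    ...   | false = refl

  inside : List Edge → VSet n → ℕ
  inside H W = ∑ H (λ (x , y) → 𝟙 (W x ∧ W y))

  module _ (U : List (Fin n)) where
    -- Vertices count with their multiplicity in `U`, since a table drawn with replacement may
    -- repeat them.
    size : VSet n → ℕ
    size W = ∑ U (𝟙 ∘ W)

    private
      size-split : ∀ (W S : VSet n) → size (λ v → W v ∧ S v) + size (λ v → W v ∧ not (S v)) ≡ size W
      size-split W S = trans (≡-sym (∑-+ U _ _)) (∑-cong U pointwise)
        where
        pointwise : ∀ v → 𝟙 (W v ∧ S v) + 𝟙 (W v ∧ not (S v)) ≡ 𝟙 (W v)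
        pointwise v with W v | S v
        ... | true  | true  = refl
        ... | true  | false = refl
        ... | false | _     = refl

      inside-split : ∀ H (W S : VSet n) → inside H W ≤
        inside H (λ v → W v ∧ S v) + inside H (λ v → W v ∧ not (S v)) + load H S
      inside-split H W S = ≤-trans (∑-mono H pointwise)
        (≤-reflexive (trans (∑-+ H _ _) (cong (_+ load H S) (∑-+ H _ _))))
        where
        pointwise : ∀ (e : Edge) → let (x , y) = e in 𝟙 (W x ∧ W y) ≤
          𝟙 ((W x ∧ S x) ∧ (W y ∧ S y)) + 𝟙 ((W x ∧ not (S x)) ∧ (W y ∧ not (S y))) + 𝟙 (S y xor S x)
        pointwise (x , y) with W x | W y | S x | S y
        ... | false | _     | _     | _     = z≤n
        ... | true  | false | _     | _     = z≤n
        ... | true  | true  | true  | true  = s≤s z≤n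
        ... | true  | true  | true  | false = s≤s z≤n
        ... | true  | true  | false | true  = s≤s z≤n
        ... | true  | true  | false | false = s≤s z≤n

      0<size : ∀ {W : VSet n} {v} → v ∈ U → W v ≡ true → 1 ≤ size W
      0<size {W} {v} i e = ≤-trans (≤-reflexive (cong 𝟙 (≡-sym e))) (∈⇒≤∑ (𝟙 ∘ W) i)

      0<parts : ∀ {W S : VSet n} {x y} → x ∈ U → y ∈ U → W x ∧ W y ≡ true → S y xor S x ≡ true →
                1 ≤ size (λ v → W v ∧ S v) × 1 ≤ size (λ v → W v ∧ not (S v))
      0<parts {W} {S} {x} {y} x∈ y∈ w s with W x in wx | W y in wy | S x in sx | S y in sy
      ... | true | true | true  | false = 0<size x∈ (cong₂ _∧_ wx sx) , 0<size y∈ (cong₂ _∧_ wy (cong not sy))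
      ... | true | true | false | true  = 0<size y∈ (cong₂ _∧_ wy sy) , 0<size x∈ (cong₂ _∧_ wx (cong not sx))

    Within : Edge → Set
    Within (x , y) = x ∈ U × y ∈ U

    -- The newest edge inside W lies in a cut of fewer than K older edges, and this cut
    -- splits W into two nonempty parts.
    inside-certificate : ∀ K es → All Within es → ∀ W → 1 ≤ size W →
                         inside (certificate K es) W + K ≤ K * size W
    inside-certificate K []       []         W h = ≤-trans (≤-reflexive (≡-sym (*-identityʳ K))) (*-monoʳ-≤ K h)
    inside-certificate K (e@(x , y) ∷ es) ((x∈ , y∈) ∷ wi) W h with splittable K (certificate K es) e in eq
    ... | false = inside-certificate K es wi W h
    ... | true with W x ∧ W y in w
    ...   | false = inside-certificate K es wi W h
    ...   | true with any-true _ (bits n) eq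
    ...     | t , _ , q = begin
      1 + inside H W + K                     ≤⟨ +-monoˡ-≤ K (s≤s (inside-split H W S)) ⟩
      1 + (inside H W₁ + inside H W₂ + load H S) + K ≡⟨ rearr (inside H W₁) (inside H W₂) (load H S) K ⟩
      inside H W₁ + inside H W₂ + K + suc (load H S) ≤⟨ +-monoʳ-≤ (inside H W₁ + inside H W₂ + K) small ⟩
      inside H W₁ + inside H W₂ + K + K      ≡⟨ rearr′ (inside H W₁) (inside H W₂) K ⟩
      (inside H W₁ + K) + (inside H W₂ + K)  ≤⟨ +-mono-≤ (inside-certificate K es wi W₁ (proj₁ parts)) (inside-certificate K es wi W₂ (proj₂ parts)) ⟩
      K * size W₁ + K * size W₂              ≡⟨ trans (≡-sym (*-distribˡ-+ K _ _)) (cong (K *_) (size-split W S)) ⟩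
      K * size W                             ∎
      where
      open ≤-Reasoning
      H = certificate K es
      S W₁ W₂ : VSet n
      S = lookup t
      W₁ v = W v ∧ S v
      W₂ v = W v ∧ not (S v)
      small : load H S < K
      small = <ᵇ⇒< (load H S) K (subst T (≡-sym (proj₂ (∧≡true q))) _)
      parts = 0<parts {W} {S} x∈ y∈ w (proj₁ (∧≡true q))
      rearr : ∀ a b l K → 1 + (a + b + l) + K ≡ a + b + K + (1 + l)
      rearr = solve-∀
      rearr′ : ∀ a b K → a + b + K + K ≡ (a + K) + (b + K)
      rearr′ = solve-∀

  length-certificate : ∀ U K es → All (Within U) es → 0 < length U →
                       length (certificate K es) ≤ K * length U
  length-certificate U K es wi h = begin
    length H                   ≡⟨ length≡∑ H ⟩
    inside H (const true)      ≤⟨ m≤m+n _ K ⟩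
    inside H (const true) + K  ≤⟨ inside-certificate U K es wi (const true) (subst (1 ≤_) (length≡∑ U) h) ⟩
    K * size U (const true)    ≡⟨ cong (K *_) (≡-sym (length≡∑ U)) ⟩
    K * length U               ∎
    where
    open ≤-Reasoning
    H = certificate K es

-- Cut sizes by pairs, degrees, and the minimum cut.

module _ {n : ℕ} (G : Graph n) where
  directed : VSet n → Fin n → Fin n → ℕ
  directed S u v = 𝟙 (S u ∧ not (S v) ∧ adj G u v)

  directed-self : ∀ S v → directed S v v ≡ 0
  directed-self S v with S v
  ... | true  = refl
  ... | false = refl

  directed-both : ∀ S v u → directed S v u + directed S u v ≡ crossing G S v u
  directed-both S v u rewrite Graph.sym G u v with S u | S v | adj G v u
  ... | true  | true  | true  = refl
  ... | true  | true  | false = refl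
  ... | true  | false | true  = refl
  ... | true  | false | false = refl
  ... | false | true  | true  = refl
  ... | false | true  | false = refl
  ... | false | false | true  = refl
  ... | false | false | false = refl

  -- The cut as the stream meets it: with the latest arrival at the head, every edge is counted at
  -- its second endpoint.
  pairCut : VSet n → List (Fin n) → ℕ
  pairCut S []       = 0
  pairCut S (v ∷ vs) = ∑ vs (crossing G S v) + pairCut S vs

  pairCut≡∑∑ : ∀ S vs → pairCut S vs ≡ ∑ vs (λ u → ∑ vs (directed S u))
  pairCut≡∑∑ S []       = refl
  pairCut≡∑∑ S (v ∷ vs) = begin
    ∑ vs (crossing G S v) + pairCut S vs
      ≡⟨ cong₂ _+_ (trans (∑-cong vs (λ u → ≡-sym (directed-both S v u))) (∑-+ vs (directed S v) (λ u → directed S u v))) (pairCut≡∑∑ S vs) ⟩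
    ∑ vs (directed S v) + ∑ vs (λ u → directed S u v) + ∑ vs (λ u → ∑ vs (directed S u))
      ≡⟨ +-assoc (∑ vs (directed S v)) _ _ ⟩
    ∑ vs (directed S v) + (∑ vs (λ u → directed S u v) + ∑ vs (λ u → ∑ vs (directed S u)))
      ≡⟨ cong₂ _+_ (cong (_+ ∑ vs (directed S v)) (≡-sym (directed-self S v))) (≡-sym (∑-+ vs (λ u → directed S u v) (λ u → ∑ vs (directed S u)))) ⟩
    ∑ (v ∷ vs) (λ u → ∑ (v ∷ vs) (directed S u)) ∎
    where open ≡-Reasoning

  pairCut-cong : ∀ {S S′} vs → (∀ {u} → u ∈ vs → S u ≡ S′ u) → pairCut S vs ≡ pairCut S′ vs
  pairCut-cong []       h = refl
  pairCut-cong (v ∷ vs) h = cong₂ _+_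
    (∑-cong-∈ vs (λ {u} i → cong₂ (λ a b → 𝟙 (adj G v u ∧ (a xor b))) (h (there i)) (h (here refl))))
    (pairCut-cong vs (h ∘ there))

  cutSize≡pairCut : ∀ S {vs} → vs ↭ allFin n → cutSize G S ≡ pairCut S vs
  cutSize≡pairCut S {vs} p = ≡-sym (trans (pairCut≡∑∑ S vs)
    (trans (∑-↭ _ p) (∑-cong (allFin n) (λ u → ∑-↭ (directed S u) p))))

  degree : Fin n → ℕ
  degree v = ∑ (allFin n) (𝟙 ∘ adj G v)

  degree≤n : ∀ v → degree v ≤ n
  degree≤n v = ≤-trans (∑-mono (allFin n) (λ u → 𝟙≤1 (adj G v u)))
    (≤-reflexive (trans (≡-sym (length≡∑ (allFin n))) (List.length-tabulate {n = n} id)))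
    where
    𝟙≤1 : ∀ x → 𝟙 x ≤ 1
    𝟙≤1 true  = s≤s z≤n
    𝟙≤1 false = z≤n

  crossing+same≡degree : ∀ S v → ∑ (allFin n) (crossing G S v) + ∑ (allFin n) (same G S v) ≡ degree v
  crossing+same≡degree S v = trans (≡-sym (∑-+ (allFin n) _ _)) (∑-cong (allFin n) (crossing+same G S v))

  ∑-crossing : ∀ S → ∑ (allFin n) (λ v → ∑ (allFin n) (crossing G S v)) ≡ 2 * cutSize G S
  ∑-crossing S = begin
    ∑ V (λ v → ∑ V (crossing G S v))
      ≡⟨ ∑-cong V (λ v → trans (∑-cong V (λ u → ≡-sym (directed-both S v u))) (∑-+ V (directed S v) (λ u → directed S u v))) ⟩
    ∑ V (λ v → ∑ V (directed S v) + ∑ V (λ u → directed S u v))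
      ≡⟨ ∑-+ V _ _ ⟩
    cutSize G S + ∑ V (λ v → ∑ V (λ u → directed S u v))
      ≡⟨ cong (cutSize G S +_) (trans (∑-swap V V (λ v u → directed S u v)) (≡-sym (+-identityʳ _))) ⟩
    2 * cutSize G S ∎
    where
    open ≡-Reasoning
    V = allFin n

others : ∀ {n} (v : Fin n) → ∃ λ vs → (v ∷ vs) ↭ allFin n × v ∉ vs
others {n} v with Mem.∈-∃++ (Mem.∈-allFin v)
... | ys , zs , eq = ys ++ zs , p , λ i → All.lookup (unique (PermS.Unique-resp-↭ (setoid (Fin n)) (↭⇒↭ₛ (↭-sym p)) (allFin⁺ n))) i refl
  where
  p : (v ∷ ys ++ zs) ↭ allFin n
  p = subst ((v ∷ ys ++ zs) ↭_) (≡-sym eq) (↭-sym (Perm.shift v ys zs))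
  unique : ∀ {vs : List (Fin n)} → Unique (v ∷ vs) → All (λ u → v ≢ u) vs
  unique (h ∷ _) = h

module _ {n : ℕ} where
  setAt : VSet n → Fin n → Bool → VSet n
  setAt S v b u = if does (u Fin.≟ v) then b else S u

  setAt-≡ : ∀ S v b → setAt S v b v ≡ b
  setAt-≡ S v b with v Fin.≟ v
  ... | yes _ = refl
  ... | no ¬e = ⊥-elim (¬e refl)

  setAt-≢ : ∀ S v b {u} → u ≢ v → setAt S v b u ≡ S u
  setAt-≢ S v b {u} ne with u Fin.≟ v
  ... | yes e = ⊥-elim (ne e)
  ... | no _  = refl

  nonemptyProper : ∀ (S : VSet n) {u v} → S u ≡ not (S v) → NonemptyProper S
  nonemptyProper S {u} {v} e with S v in eq
  ... | true  = (v , eq) , (u , e)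
  ... | false = (u , e) , (v , eq)

∉⇒≢ : {xs : List A} {x y : A} → x ∉ xs → y ∈ xs → y ≢ x
∉⇒≢ ni i refl = ni i

module _ {n : ℕ} (G : Graph n) where
  private
    V = allFin n

    ∑-others : ∀ {v vs} (f : Fin n → ℕ) → (v ∷ vs) ↭ V → f v ≡ 0 → ∑ V f ≡ ∑ vs f
    ∑-others {v} {vs} f p e = trans (≡-sym (∑-↭ f p)) (cong (_+ ∑ vs f) e)

    adj-self : ∀ v (x : Bool) → 𝟙 (adj G v v ∧ x) ≡ 0
    adj-self v x rewrite Graph.loopless G v = refl

  cutSize-others : ∀ S {v vs} → (v ∷ vs) ↭ V →
                   cutSize G S ≡ ∑ V (crossing G S v) + pairCut G S vs
  cutSize-others S {v} {vs} p = trans (cutSize≡pairCut G S p)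
    (cong (_+ pairCut G S vs) (≡-sym (∑-others (crossing G S v) p (adj-self v (S v xor S v)))))

  cutSize-singleton : ∀ v → cutSize G (setAt (const false) v true) ≡ degree G v
  cutSize-singleton v with others v
  ... | vs , p , v∉ = begin
    cutSize G S                           ≡⟨ cutSize≡pairCut G S p ⟩
    ∑ vs (crossing G S v) + pairCut G S vs ≡⟨ cong₂ _+_ (∑-cong-∈ vs (λ {u} i → eq u (setAt-≢ (const false) v true (∉⇒≢ v∉ i))))
                                              (trans (pairCut-cong G vs (λ i → setAt-≢ (const false) v true (∉⇒≢ v∉ i))) (zero-cut vs)) ⟩
    ∑ vs (𝟙 ∘ adj G v) + 0                ≡⟨ +-identityʳ _ ⟩
    ∑ vs (𝟙 ∘ adj G v)                    ≡⟨ ≡-sym (∑-others (𝟙 ∘ adj G v) p (cong 𝟙 (Graph.loopless G v))) ⟩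
    degree G v                            ∎
    where
    open ≡-Reasoning
    S = setAt (const false) v true
    eq : ∀ u → S u ≡ false → crossing G S v u ≡ 𝟙 (adj G v u)
    eq u e rewrite e | setAt-≡ (const false) v true with adj G v u
    ... | true  = refl
    ... | false = refl
    zero-cut : ∀ vs → pairCut G (const false) vs ≡ 0
    zero-cut []       = refl
    zero-cut (w ∷ vs) = cong₂ _+_ (trans (∑-cong vs (λ u → cong 𝟙 (∧-zeroʳ (adj G w u)))) (∑-zero vs)) (zero-cut vs)

  -- Moving `v` to the other side exchanges its crossing and non-crossing edges and changes nothing
  -- else, so minimality gives the claim whenever the new set is still a proper cut. Otherwise `v`
  -- is alone on its side, and `S` cuts every edge at `v`, against the bound by the degree.
  minimum-cut-crossing≤same : ∀ S → (∀ S′ → NonemptyProper S′ → cutSize G S ≤ cutSize G S′) →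
    (∀ v → cutSize G S < degree G v) →
    ∀ v → ∑ V (crossing G S v) ≤ ∑ V (same G S v)
  minimum-cut-crossing≤same S min lt v with others v
  ... | vs , p , v∉ with any (λ u → not (S u xor S v)) vs in eq
  ...   | false = ⊥-elim (<⇒≱ (lt v) (begin
    degree G v                     ≡⟨ ∑-others (𝟙 ∘ adj G v) p (cong 𝟙 (Graph.loopless G v)) ⟩
    ∑ vs (𝟙 ∘ adj G v)             ≡⟨ ∑-cong-∈ vs (λ {u} i → all-cross u (any-false _ eq i)) ⟩
    ∑ vs (crossing G S v)          ≡⟨ ≡-sym (∑-others (crossing G S v) p (adj-self v (S v xor S v))) ⟩
    ∑ V (crossing G S v)           ≤⟨ m≤m+n _ _ ⟩
    ∑ V (crossing G S v) + pairCut G S vs ≡⟨ ≡-sym (cutSize-others S p) ⟩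
    cutSize G S                    ∎))
    where
    open ≤-Reasoning
    all-cross : ∀ u → not (S u xor S v) ≡ false → 𝟙 (adj G v u) ≡ crossing G S v u
    all-cross u e with S u xor S v | adj G v u
    ... | true | true  = refl
    ... | true | false = refl
  ...   | true with any-true _ vs eq
  ...     | u , u∈ , q = +-cancelʳ-≤ (pairCut G S vs) _ _ (begin
    ∑ V (crossing G S v) + pairCut G S vs     ≡⟨ ≡-sym (cutSize-others S p) ⟩
    cutSize G S                               ≤⟨ min S′ (nonemptyProper S′ {u} {v} differ) ⟩
    cutSize G S′                              ≡⟨ cutSize≡pairCut G S′ p ⟩
    ∑ vs (crossing G S′ v) + pairCut G S′ vs  ≡⟨ cong₂ _+_ (∑-cong-∈ vs (λ {w} i → flipped w (agree i))) (pairCut-cong G vs agree) ⟩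
    ∑ vs (same G S v) + pairCut G S vs        ≡⟨ cong (_+ pairCut G S vs) (≡-sym (∑-others (same G S v) p (adj-self v (not (S v xor S v))))) ⟩
    ∑ V (same G S v) + pairCut G S vs         ∎)
    where
    open ≤-Reasoning
    S′ = setAt S v (not (S v))
    agree : ∀ {w} → w ∈ vs → S′ w ≡ S w
    agree i = setAt-≢ S v (not (S v)) (∉⇒≢ v∉ i)
    differ : S′ u ≡ not (S′ v)
    differ = trans (agree u∈) (trans (not-xor⇒≡ _ _ q) (trans (≡-sym (not-involutive (S v))) (cong not (≡-sym (setAt-≡ S v (not (S v)))))))
    flipped : ∀ w → S′ w ≡ S w → crossing G S′ v w ≡ same G S v w
    flipped w e rewrite e | setAt-≡ S v (not (S v)) with S w | S v
    ... | true  | true  = refl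
    ... | true  | false = refl
    ... | false | true  = refl
    ... | false | false = refl

argmin : (f : A → ℕ) (xs : List A) {x : A} → x ∈ xs → ∃ λ y → y ∈ xs × ∀ {z} → z ∈ xs → f y ≤ f z
argmin f (x ∷ []) _ = x , here refl , λ { (here refl) → ≤-refl }
argmin f (x ∷ xs@(_ ∷ _)) _ with argmin f xs (here refl)
... | y , y∈ , min with ≤-total (f x) (f y)
...   | inj₁ le = x , here refl , λ { (here refl) → ≤-refl ; (there i) → ≤-trans le (min i) }
...   | inj₂ le = y , there y∈ , λ { (here refl) → le ; (there i) → min i }

∈-filterᵇ⁺ : (p : A → Bool) {xs : List A} {x : A} → x ∈ xs → p x ≡ true → x ∈ filterᵇ p xs
∈-filterᵇ⁺ p i e = Mem.∈-filter⁺ (T? ∘ p) i (subst T (≡-sym e) _)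

∈-filterᵇ⁻ : (p : A → Bool) {xs : List A} {x : A} → x ∈ filterᵇ p xs → p x ≡ true
∈-filterᵇ⁻ p {xs} i = T⇒≡true (proj₂ (Mem.∈-filter⁻ (T? ∘ p) {xs = xs} i))

isSplit : (A → Bool) → List A → Bool
isSplit S vs = any S vs ∧ any (not ∘ S) vs

module _ {n : ℕ} where
  isSplit⇒nonemptyProper : ∀ {S : VSet n} vs → isSplit S vs ≡ true → NonemptyProper S
  isSplit⇒nonemptyProper {S} vs e with ∧≡true {any S vs} e
  ... | p , q with any-true S vs p | any-true (not ∘ S) vs q
  ...   | u , _ , a | v , _ , b = (u , a) , (v , not≡true⇒≡false b)

  nonemptyProper⇒isSplit : ∀ {S : VSet n} {vs} → (∀ v → v ∈ vs) → NonemptyProper S → isSplit S vs ≡ true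
  nonemptyProper⇒isSplit {S} h ((u , a) , (v , b)) =
    cong₂ _∧_ (any-∈ S (h u) a) (any-∈ (not ∘ S) (h v) (cong not b))

  NonemptyProper-cong : ∀ {S S′ : VSet n} → (∀ v → S v ≡ S′ v) → NonemptyProper S → NonemptyProper S′
  NonemptyProper-cong h ((u , a) , (v , b)) = (u , trans (≡-sym (h u)) a) , (v , trans (≡-sym (h v)) b)

  cutSize-cong : ∀ (G : Graph n) {S S′} → (∀ v → S v ≡ S′ v) → cutSize G S ≡ cutSize G S′
  cutSize-cong G h = ∑-cong (allFin n) (λ u → ∑-cong (allFin n) (λ v →
    cong₂ (λ a b → 𝟙 (a ∧ not b ∧ adj G u v)) (h u) (h v)))

singleton-nonemptyProper : ∀ {n} (v : Fin (suc (suc n))) → NonemptyProper (setAt (const false) v true)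
singleton-nonemptyProper v = nonemptyProper (setAt (const false) v true) {v} {proj₁ w}
  (trans (setAt-≡ (const false) v true) (cong not (≡-sym (setAt-≢ (const false) v true (proj₂ w)))))
  where
  other : ∀ {n} (v : Fin (suc (suc n))) → ∃ λ u → u ≢ v
  other zero    = suc zero , λ ()
  other (suc v) = zero , λ ()
  w = other v

module _ {n : ℕ} (G : Graph (suc (suc n))) where
  private
    proper : Vec Bool (suc (suc n)) → Bool
    proper t = isSplit (lookup t) (allFin (suc (suc n)))

    proper-∈ : ∀ S → NonemptyProper S → Vec.tabulate S ∈ filterᵇ proper (bits (suc (suc n)))
    proper-∈ S np = ∈-filterᵇ⁺ proper (∈-bits (Vec.tabulate S)) (nonemptyProper⇒isSplit Mem.∈-allFin
      (NonemptyProper-cong (λ v → ≡-sym (Vec.lookup∘tabulate S v)) np))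

  minimum-cut : ∃ λ S → NonemptyProper S × (∀ S′ → NonemptyProper S′ → cutSize G S ≤ cutSize G S′)
  minimum-cut with argmin (λ t → cutSize G (lookup t)) (filterᵇ proper (bits (suc (suc n))))
                          (proper-∈ _ (singleton-nonemptyProper zero))
  ... | t , t∈ , min = lookup t
    , isSplit⇒nonemptyProper (allFin (suc (suc n))) (∈-filterᵇ⁻ proper {bits (suc (suc n))} t∈)
    , λ S np → ≤-trans (min (proper-∈ S np)) (≤-reflexive (cutSize-cong G (Vec.lookup∘tabulate S)))

-- Independent repetition

𝟙-∧ : ∀ x y → 𝟙 (x ∧ y) ≡ 𝟙 x * 𝟙 y
𝟙-∧ true  y = ≡-sym (+-identityʳ (𝟙 y))
𝟙-∧ false y = refl

module _ (w : ℕ → ℕ) (keep : ∀ i → Vec Bool (w i) → Bool) (j : ℕ) where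
  -- Only the trials at scale `j` count as chances; the bits of the other trials are arbitrary.
  missed : ∀ is → Vec Bool (∑ is w) → Bool
  missed []       r = true
  missed (i ∷ is) r = not ((j ≡ᵇ i) ∧ keep i (take (w i) r)) ∧ missed is (drop (w i) r)

  module _ (P : ℕ) (keep-count : 2 ^ w j ≤ suc P * ∑ (bits (w j)) (𝟙 ∘ keep j)) where
    private
      h : ℕ → ℕ
      h i = 𝟙 (j ≡ᵇ i)

    -- The exponent `h i` treats both kinds of trial at once: a trial at scale `j` fails with
    -- probability at most `P / (1 + P)`, any other contributes the factor 1.
    trial-count : ∀ i → ∑ (bits (w i)) (λ x → 𝟙 (not ((j ≡ᵇ i) ∧ keep i x))) * suc P ^ h i ≤ P ^ h i * 2 ^ w i
    trial-count i with j ≡ᵇ i in eq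
    ... | false = ≤-reflexive (trans (*-identityʳ _) (trans (∑-bits-const (w i) 1) (*-comm (2 ^ w i) 1)))
    ... | true with refl ← ≡ᵇ⇒≡ j i (subst T (≡-sym eq) _) = +-cancelʳ-≤ X _ _ (begin
      miss * (suc P * 1) + X        ≡⟨ cong (λ z → miss * z + X) (*-identityʳ (suc P)) ⟩
      miss * suc P + X              ≤⟨ +-monoʳ-≤ (miss * suc P) keep-count ⟩
      miss * suc P + suc P * kept   ≡⟨ rearr miss kept P ⟩
      suc P * (kept + miss)         ≡⟨ cong (suc P *_) total ⟩
      X + P * X                     ≡⟨ rearr′ P X ⟩
      P * 1 * X + X                 ∎)
      where
      open ≤-Reasoning
      X = 2 ^ w j
      kept = ∑ (bits (w j)) (𝟙 ∘ keep j)
      miss = ∑ (bits (w j)) (λ x → 𝟙 (not (keep j x)))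
      total : kept + miss ≡ X
      total = trans (≡-sym (∑-+ (bits (w j)) _ _)) (trans (∑-cong (bits (w j)) (λ x → 𝟙-not (keep j x)))
                (trans (∑-bits-const (w j) 1) (*-identityʳ X)))
      rearr : ∀ m k P → m * (1 + P) + (1 + P) * k ≡ (1 + P) * (k + m)
      rearr = solve-∀
      rearr′ : ∀ P X → X + P * X ≡ P * 1 * X + X
      rearr′ = solve-∀

    missed-count : ∀ is → ∑ (bits (∑ is w)) (𝟙 ∘ missed is) * suc P ^ ∑ is h ≤ P ^ ∑ is h * 2 ^ ∑ is w
    missed-count []       = ≤-refl
    missed-count (i ∷ is) = begin
      ∑ (bits (w i + ∑ is w)) (𝟙 ∘ missed (i ∷ is)) * suc P ^ (h i + ∑ is h)
        ≡⟨ cong₂ _*_ (trans (∑-cong (bits (w i + ∑ is w)) (λ r → 𝟙-∧ (not ((j ≡ᵇ i) ∧ keep i (take (w i) r))) _))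
                       (∑-bits-* (w i) (∑ is w) (λ x → 𝟙 (not ((j ≡ᵇ i) ∧ keep i x))) (𝟙 ∘ missed is)))
                     (^-distribˡ-+-* (suc P) (h i) (∑ is h)) ⟩
      a * c * (suc P ^ h i * suc P ^ ∑ is h)     ≡⟨ rearr a c (suc P ^ h i) (suc P ^ ∑ is h) ⟩
      a * suc P ^ h i * (c * suc P ^ ∑ is h)     ≤⟨ *-mono-≤ (trial-count i) (missed-count is) ⟩
      P ^ h i * 2 ^ w i * (P ^ ∑ is h * 2 ^ ∑ is w) ≡⟨ rearr (P ^ h i) (2 ^ w i) (P ^ ∑ is h) (2 ^ ∑ is w) ⟩
      P ^ h i * P ^ ∑ is h * (2 ^ w i * 2 ^ ∑ is w) ≡⟨ cong₂ _*_ (≡-sym (^-distribˡ-+-* P (h i) (∑ is h))) (≡-sym (^-distribˡ-+-* 2 (w i) (∑ is w))) ⟩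
      P ^ (h i + ∑ is h) * 2 ^ (w i + ∑ is w)    ∎
      where
      open ≤-Reasoning
      a = ∑ (bits (w i)) (λ x → 𝟙 (not ((j ≡ᵇ i) ∧ keep i x)))
      c = ∑ (bits (∑ is w)) (𝟙 ∘ missed is)
      rearr : ∀ a b c d → a * b * (c * d) ≡ a * c * (b * d)
      rearr = solve-∀

    missed-rare : ∀ is t → suc P * t ≤ ∑ is h →
                  ∑ (bits (∑ is w)) (𝟙 ∘ missed is) * 2 ^ t ≤ 2 ^ ∑ is w
    missed-rare is t le = *-cancelʳ-≤ _ _ (suc P ^ e) {{m^n≢0 (suc P) e}} (begin
      c * 2 ^ t * suc P ^ e              ≡⟨ rearr c (2 ^ t) (suc P ^ e) ⟩
      c * suc P ^ e * 2 ^ t              ≤⟨ *-monoˡ-≤ (2 ^ t) (missed-count is) ⟩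
      P ^ e * Z * 2 ^ t                  ≡⟨ rearr (P ^ e) Z (2 ^ t) ⟩
      P ^ e * 2 ^ t * Z                  ≤⟨ *-monoˡ-≤ Z shrink ⟩
      suc P ^ e * Z                      ≡⟨ *-comm (suc P ^ e) Z ⟩
      Z * suc P ^ e                      ∎)
      where
      open ≤-Reasoning
      e = ∑ is h
      c = ∑ (bits (∑ is w)) (𝟙 ∘ missed is)
      Z = 2 ^ ∑ is w
      s = e ∸ suc P * t
      e≡ : e ≡ suc P * t + s
      e≡ = ≡-sym (m+[n∸m]≡n le)
      rearr : ∀ a b c → a * b * c ≡ a * c * b
      rearr = solve-∀
      shrink : P ^ e * 2 ^ t ≤ suc P ^ e
      shrink = begin
        P ^ e * 2 ^ t                            ≡⟨ cong (λ z → P ^ z * 2 ^ t) e≡ ⟩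
        P ^ (suc P * t + s) * 2 ^ t              ≡⟨ cong (_* 2 ^ t) (^-distribˡ-+-* P (suc P * t) s) ⟩
        P ^ (suc P * t) * P ^ s * 2 ^ t          ≡⟨ rearr (P ^ (suc P * t)) (P ^ s) (2 ^ t) ⟩
        P ^ (suc P * t) * 2 ^ t * P ^ s          ≤⟨ *-mono-≤ (x^[[1+x]t]*2^t≤ P t) (^-monoˡ-≤ s (n≤1+n P)) ⟩
        suc P ^ (suc P * t) * suc P ^ s          ≡⟨ ≡-sym (^-distribˡ-+-* (suc P) (suc P * t) s) ⟩
        suc P ^ (suc P * t + s)                  ≡⟨ cong (suc P ^_) (≡-sym e≡) ⟩
        suc P ^ e                                ∎

∑-repeat : ∀ t (xs : List A) (f : A → ℕ) → ∑ (concat (replicate t xs)) f ≡ t * ∑ xs f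
∑-repeat zero    xs f = refl
∑-repeat (suc t) xs f = trans (∑-++ xs _ f) (cong (∑ xs f +_) (∑-repeat t xs f))

∈-repeat⁻ : ∀ t {xs : List A} {x} → x ∈ concat (replicate t xs) → x ∈ xs
∈-repeat⁻ (suc t) {xs} i with Mem.∈-++⁻ xs i
... | inj₁ j = j
... | inj₂ j = ∈-repeat⁻ t j

∑-≤-length : (xs : List A) {f : A → ℕ} (M : ℕ) → (∀ {x} → x ∈ xs → f x ≤ M) → ∑ xs f ≤ length xs * M
∑-≤-length []       M h = z≤n
∑-≤-length (x ∷ xs) M h = +-mono-≤ (h (here refl)) (∑-≤-length xs M (h ∘ there))

n<2^[1+⌊log₂n⌋] : ∀ n → n < 2 ^ suc ⌊log₂ n ⌋
n<2^[1+⌊log₂n⌋] n = ≰⇒> (λ le → <⇒≱ (n<1+n ⌊log₂ n ⌋)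
  (subst (_≤ ⌊log₂ n ⌋) (⌊log₂[2^n]⌋≡n (suc ⌊log₂ n ⌋)) (⌊log₂⌋-mono-≤ le)))

2^⌊log₂n⌋≤n : ∀ n → 0 < n → 2 ^ ⌊log₂ n ⌋ ≤ n
2^⌊log₂n⌋≤n n = go n (<-wellFounded n)
  where
  go : ∀ n → Acc _<_ n → 0 < n → 2 ^ ⌊log₂ n ⌋ ≤ n
  go 1                 _        _ = s≤s z≤n
  go n@(suc (suc n′)) (acc rs) _ = begin
    2 ^ ⌊log₂ n ⌋                   ≡⟨ cong (2 ^_) (≡-sym (suc-pred ⌊log₂ n ⌋ {{>-nonZero (⌊log₂⌋-mono-≤ {2} {n} (s≤s (s≤s z≤n)))}})) ⟩
    2 * 2 ^ pred ⌊log₂ n ⌋          ≡⟨ cong (λ l → 2 * 2 ^ l) (≡-sym (⌊log₂⌊n/2⌋⌋≡⌊log₂n⌋∸1 n)) ⟩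
    2 * 2 ^ ⌊log₂ ⌊ n /2⌋ ⌋         ≤⟨ *-monoʳ-≤ 2 (go ⌊ n /2⌋ (rs (⌊n/2⌋<n (suc n′))) (s≤s z≤n)) ⟩
    2 * ⌊ n /2⌋                     ≡⟨ cong (⌊ n /2⌋ +_) (+-identityʳ _) ⟩
    ⌊ n /2⌋ + ⌊ n /2⌋               ≤⟨ +-monoʳ-≤ ⌊ n /2⌋ (⌊n/2⌋≤⌈n/2⌉ n) ⟩
    ⌊ n /2⌋ + ⌈ n /2⌉               ≡⟨ ⌊n/2⌋+⌈n/2⌉≡n n ⟩
    n                               ∎
    where open ≤-Reasoning

-- Prefix codes: decoding returns the unread suffix, so codes compose by concatenation.
record Codec (A : Set) : Set where
  field
    encode        : A → List Bool
    decode        : List Bool → A × List Bool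
    decode-encode : ∀ a ys → decode (encode a ++ ys) ≡ (a , ys)
open Codec

bitsCodec : ∀ k → Codec (Vec Bool k)
bitsCodec k = record { encode = Vec.toList ; decode = read k ; decode-encode = read-toList }
  where
  read : ∀ k → List Bool → Vec Bool k × List Bool
  read zero    ys       = [] , ys
  read (suc k) []       = Vec.replicate (suc k) false , []
  read (suc k) (y ∷ ys) = let x , zs = read k ys in y ∷ x , zs
  read-toList : ∀ {k} (x : Vec Bool k) ys → read k (Vec.toList x ++ ys) ≡ (x , ys)
  read-toList []      ys = refl
  read-toList (b ∷ x) ys rewrite read-toList x ys = refl

-- Unary is affordable: it is used for list lengths, at one bit per entry, and for one degree bound
-- of at most the number of vertices.
unaryCodec : Codec ℕ
unaryCodec = record { encode = enc ; decode = dec ; decode-encode = dec-enc }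
  where
  enc : ℕ → List Bool
  enc n = replicate n true ++ false ∷ []
  dec : List Bool → ℕ × List Bool
  dec []           = 0 , []
  dec (false ∷ ys) = 0 , ys
  dec (true  ∷ ys) = let n , zs = dec ys in suc n , zs
  dec-enc : ∀ n ys → dec (enc n ++ ys) ≡ (n , ys)
  dec-enc zero    ys = refl
  dec-enc (suc n) ys rewrite dec-enc n ys = refl

pairCodec : Codec A → Codec B → Codec (A × B)
pairCodec {A} {B} ca cb = record { encode = enc ; decode = dec ; decode-encode = dec-enc }
  where
  enc : A × B → List Bool
  enc (a , b) = encode ca a ++ encode cb b
  dec : List Bool → (A × B) × List Bool
  dec ys = let a , zs = decode ca ys ; b , ws = decode cb zs in (a , b) , ws
  dec-enc : ∀ p ys → dec (enc p ++ ys) ≡ (p , ys)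
  dec-enc (a , b) ys rewrite List.++-assoc (encode ca a) (encode cb b) ys
                           | decode-encode ca a (encode cb b ++ ys)
                           | decode-encode cb b ys = refl

listCodec : Codec A → Codec (List A)
listCodec {A} ca = record { encode = enc ; decode = dec ; decode-encode = dec-enc }
  where
  enc : List A → List Bool
  enc xs = encode unaryCodec (length xs) ++ concatMap (encode ca) xs
  read : ℕ → List Bool → List A × List Bool
  read zero    ys = [] , ys
  read (suc k) ys = let x , zs = decode ca ys ; xs , ws = read k zs in x ∷ xs , ws
  dec : List Bool → List A × List Bool
  dec ys = let k , zs = decode unaryCodec ys in read k zs
  read-encode : ∀ xs ys → read (length xs) (concatMap (encode ca) xs ++ ys) ≡ (xs , ys)
  read-encode []       ys = refl
  read-encode (x ∷ xs) ys rewrite List.++-assoc (encode ca x) (concatMap (encode ca) xs) ys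
                                | decode-encode ca x (concatMap (encode ca) xs ++ ys)
                                | read-encode xs ys = refl
  dec-enc : ∀ xs ys → dec (enc xs ++ ys) ≡ (xs , ys)
  dec-enc xs ys rewrite List.++-assoc (encode unaryCodec (length xs)) (concatMap (encode ca) xs) ys
                      | decode-encode unaryCodec (length xs) (concatMap (encode ca) xs ++ ys) = read-encode xs ys

vertexCodec : ∀ {n} b → suc n ≤ 2 ^ b → Codec (Fin (suc n))
vertexCodec {n} b le = record { encode = enc ; decode = dec ; decode-encode = dec-enc }
  where
  enc : Fin (suc n) → List Bool
  enc u = encode (bitsCodec b) (binary b (toℕ u))
  dec : List Bool → Fin (suc n) × List Bool
  dec ys = let x , zs = decode (bitsCodec b) ys in fromMaybe zero (sample x) , zs
  dec-enc : ∀ u ys → dec (enc u ++ ys) ≡ (u , ys)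
  dec-enc u ys rewrite decode-encode (bitsCodec b) (binary b (toℕ u)) ys
                     | value-binary b (toℕ u) (≤-trans (toℕ<n u) le)
                     | fromℕ?-toℕ u = refl

length-unary : ∀ n → length (encode unaryCodec n) ≡ suc n
length-unary zero    = refl
length-unary (suc n) = cong suc (length-unary n)

length-pair : ∀ (ca : Codec A) (cb : Codec B) a b →
              length (encode (pairCodec ca cb) (a , b)) ≡ length (encode ca a) + length (encode cb b)
length-pair ca cb a b = List.length-++ (encode ca a)

length-list : ∀ (ca : Codec A) xs →
              length (encode (listCodec ca) xs) ≡ suc (length xs) + ∑ xs (length ∘ encode ca)
length-list ca xs = trans (List.length-++ (encode unaryCodec (length xs)))
                          (cong₂ _+_ (length-unary (length xs)) (go xs))
  where
  go : ∀ xs → length (concatMap (encode ca) xs) ≡ ∑ xs (length ∘ encode ca)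
  go []       = refl
  go (x ∷ xs) = trans (List.length-++ (encode ca x)) (cong (length (encode ca x) +_) (go xs))

length-vertex : ∀ {n} b (le : suc n ≤ 2 ^ b) u → length (encode (vertexCodec b le) u) ≡ b
length-vertex b le u = Vec.length-toList (binary b (toℕ u))

-- The streaming algorithm

isSplit-map : (S : B → Bool) (f : A → B) (xs : List A) → isSplit S (map f xs) ≡ isSplit (S ∘ f) xs
isSplit-map S f xs = cong₂ (λ p q → or p ∧ or q) (≡-sym (List.map-∘ xs)) (≡-sym (List.map-∘ xs))

⊓-foldr-≤ : ∀ m xs → foldr _⊓_ m xs ≤ m
⊓-foldr-≤ m []       = ≤-refl
⊓-foldr-≤ m (x ∷ xs) = ≤-trans (m⊓n≤n x _) (⊓-foldr-≤ m xs)

⊓-foldr-∈ : ∀ m {xs x} → x ∈ xs → foldr _⊓_ m xs ≤ x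
⊓-foldr-∈ m (here refl)            = m⊓n≤m _ _
⊓-foldr-∈ m {y ∷ xs} (there i)     = ≤-trans (m⊓n≤n y _) (⊓-foldr-∈ m i)

≤-foldr-⊓ : ∀ {k m xs} → k ≤ m → All (k ≤_) xs → k ≤ foldr _⊓_ m xs
≤-foldr-⊓ h []       = h
≤-foldr-⊓ h (x ∷ xs) = ⊓-glb x (≤-foldr-⊓ h xs)

module Algorithm {n : ℕ} (b : ℕ) (n<2^b : suc n ≤ 2 ^ b) where
  V : Set
  V = Fin (suc n)

  width : ℕ → ℕ
  width i = trialBits (suc n) b (2 ^ (b ∸ i))

  threshold : ℕ → ℕ
  threshold i = 2 ^ suc i

  center : ∀ i → Vec Bool (width i) → V → (V → Bool) → V
  center i s v row = label b (2 ^ (b ∸ i)) zero s v row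

  -- The labels of the vertices seen so far, and the certificate of the contracted edges.
  TrialState : Set
  TrialState = List (V × V) × List (V × V)

  -- Parallel edges stay as repetitions, since cuts of the contraction count multiplicities. An edge
  -- between equal labels is separated by no set, so `addEdge` discards it.
  newEdges : (V → Bool) → V → List (V × V) → List (V × V)
  newEdges row c labels = map (λ (_ , d) → c , d) (filterᵇ (row ∘ proj₁) labels)

  stepTrial : ∀ i → Vec Bool (width i) → V → (V → Bool) → TrialState → TrialState
  stepTrial i s v row (labels , H) =
    let c = center i s v row in
    (v , c) ∷ labels , foldr (addEdge (threshold i)) H (newEdges row c labels)

  -- The split is tested on the labels in use, which makes `S ∘ f` a proper cut of the graph; the
  -- bound on the load makes the stored value its exact size.
  eligible : ℕ → TrialState → VSet (suc n) → Bool
  eligible i (labels , H) S = isSplit (S ∘ proj₂) labels ∧ (load H S <ᵇ threshold i)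

  candidates : ℕ → TrialState → List ℕ
  candidates i ts@(_ , H) = map (load H ∘ lookup) (filterᵇ (eligible i ts ∘ lookup) (bits (suc n)))

  stepTrials : ∀ is → Vec Bool (∑ is width) → V → (V → Bool) → List TrialState → List TrialState
  stepTrials []       r v row ts       = []
  stepTrials (i ∷ is) r v row []       = []
  stepTrials (i ∷ is) r v row (t ∷ ts) =
    stepTrial i (take (width i) r) v row t ∷ stepTrials is (drop (width i) r) v row ts

  allCandidates : List ℕ → List TrialState → List ℕ
  allCandidates (i ∷ is) (t ∷ ts) = candidates i t ++ allCandidates is ts
  allCandidates _        _        = []

  module _ (is : List ℕ) where
    State : Set
    State = Vec Bool (∑ is width) × ℕ × List TrialState

    edgesCodec : Codec (List (V × V))
    edgesCodec = listCodec (pairCodec (vertexCodec b n<2^b) (vertexCodec b n<2^b))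

    stateCodec : Codec State
    stateCodec = pairCodec (bitsCodec _) (pairCodec unaryCodec (listCodec (pairCodec edgesCodec edgesCodec)))

    decodeState : Memory → State
    decodeState m = proj₁ (decode stateCodec m)

    stepState : State → V → (V → Bool) → State
    stepState (r , best , ts) v row = r , best ⊓ ∑ (allFin (suc n)) (𝟙 ∘ row) , stepTrials is r v row ts

    outputState : State → ℕ
    outputState (r , best , ts) = foldr _⊓_ best (allCandidates is ts)

    algorithm : StreamAlg (suc n)
    algorithm = record
      { randBits = ∑ is width
      -- The number of vertices, at least every degree, is a neutral start for the running minimum
      -- of degrees.
      ; init     = λ r → encode stateCodec (r , suc n , map (const ([] , [])) is)
      ; step     = λ m v row → encode stateCodec (stepState (decodeState m) v row)
      ; output   = outputState ∘ decodeState
      }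

    decode-state : ∀ s → decodeState (encode stateCodec s) ≡ s
    decode-state s = cong proj₁ (trans (cong (decode stateCodec) (≡-sym (List.++-identityʳ _))) (decode-encode stateCodec s []))

  module _ (G : Graph (suc n)) where
    -- Lists of seen vertices have the latest arrival first.
    centerOf : ∀ i → Vec Bool (width i) → V → V
    centerOf i s v = center i s v (adj G v)

    labelsOf : (V → V) → List V → List (V × V)
    labelsOf f = map (λ u → u , f u)

    contracted : (V → V) → List V → List (V × V)
    contracted f []       = []
    contracted f (v ∷ vs) = newEdges (adj G v) (f v) (labelsOf f vs) ++ contracted f vs

    trialAt : ∀ i → Vec Bool (width i) → List V → TrialState
    trialAt i s vs = labelsOf (centerOf i s) vs , certificate (threshold i) (contracted (centerOf i s) vs)

    trialsAt : ∀ is → Vec Bool (∑ is width) → List V → List TrialState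
    trialsAt []       r vs = []
    trialsAt (i ∷ is) r vs = trialAt i (take (width i) r) vs ∷ trialsAt is (drop (width i) r) vs

    bestAt : List V → ℕ
    bestAt []       = suc n
    bestAt (v ∷ vs) = bestAt vs ⊓ degree G v

    -- A closed form of the memory in terms of the random string and the reversed prefix of the
    -- stream; space and correctness are both read off from it.
    stateAt : ∀ is → Vec Bool (∑ is width) → List V → State is
    stateAt is r vs = r , bestAt vs , trialsAt is r vs

    load-contracted : ∀ f T vs → load (contracted f vs) T ≡ pairCut G (T ∘ f) vs
    load-contracted f T []       = refl
    load-contracted f T (v ∷ vs) = trans (∑-++ (newEdges (adj G v) (f v) (labelsOf f vs)) _ _)
      (cong₂ _+_ (begin
        load (newEdges (adj G v) (f v) (labelsOf f vs)) T
          ≡⟨ ∑-map (filterᵇ (adj G v ∘ proj₁) (labelsOf f vs)) _ _ ⟩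
        ∑ (filterᵇ (adj G v ∘ proj₁) (labelsOf f vs)) (λ (_ , d) → 𝟙 (T d xor T (f v)))
          ≡⟨ ∑-filter (labelsOf f vs) (adj G v ∘ proj₁) _ ⟩
        ∑ (labelsOf f vs) (λ (u , d) → if adj G v u then 𝟙 (T d xor T (f v)) else 0)
          ≡⟨ ∑-map vs _ _ ⟩
        ∑ vs (λ u → if adj G v u then 𝟙 (T (f u) xor T (f v)) else 0)
          ≡⟨ ∑-cong vs if-∧ ⟩
        ∑ vs (crossing G (T ∘ f) v) ∎) (load-contracted f T vs))
      where
      open ≡-Reasoning
      if-∧ : ∀ u → (if adj G v u then 𝟙 (T (f u) xor T (f v)) else 0) ≡ crossing G (T ∘ f) v u
      if-∧ u with adj G v u
      ... | true  = refl
      ... | false = refl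

    stepTrial-trialAt : ∀ i s v vs → stepTrial i s v (adj G v) (trialAt i s vs) ≡ trialAt i s (v ∷ vs)
    stepTrial-trialAt i s v vs = cong (labelsOf (centerOf i s) (v ∷ vs) ,_)
      (≡-sym (List.foldr-++ (addEdge (threshold i)) [] (newEdges (adj G v) (centerOf i s v) (labelsOf (centerOf i s) vs)) _))

    stepTrials-trialsAt : ∀ is r v vs → stepTrials is r v (adj G v) (trialsAt is r vs) ≡ trialsAt is r (v ∷ vs)
    stepTrials-trialsAt []       r v vs = refl
    stepTrials-trialsAt (i ∷ is) r v vs = cong₂ _∷_ (stepTrial-trialAt i _ v vs) (stepTrials-trialsAt is _ v vs)

    trialsAt-[] : ∀ is r → map (const ([] , [])) is ≡ trialsAt is r []
    trialsAt-[] []       r = refl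
    trialsAt-[] (i ∷ is) r = cong (([] , []) ∷_) (trialsAt-[] is (drop (width i) r))

    module _ (is : List ℕ) (r : Vec Bool (∑ is width)) where
      memoryAt : List V → Memory
      memoryAt vs = encode (stateCodec is) (stateAt is r vs)

      init≡memoryAt : init (algorithm is) r ≡ memoryAt []
      init≡memoryAt = cong (λ ts → encode (stateCodec is) (r , suc n , ts)) (trialsAt-[] is r)

      step-memoryAt : ∀ v vs → step (algorithm is) (memoryAt vs) v (adj G v) ≡ memoryAt (v ∷ vs)
      step-memoryAt v vs = cong (encode (stateCodec is)) (trans
        (cong (λ s → stepState is s v (adj G v)) (decode-state is (stateAt is r vs)))
        (cong (λ ts → r , bestAt (v ∷ vs) , ts) (stepTrials-trialsAt is r v vs)))

      final-memoryAt : ∀ vs ws → final (algorithm is) G (memoryAt vs) ws ≡ memoryAt (ws ʳ++ vs)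
      final-memoryAt vs []       = refl
      final-memoryAt vs (v ∷ ws) = trans (cong (λ m → final (algorithm is) G m ws) (step-memoryAt v vs)) (final-memoryAt (v ∷ vs) ws)

      output-final : ∀ ws → output (algorithm is) (final (algorithm is) G (init (algorithm is) r) ws)
                            ≡ outputState is (stateAt is r (ws ʳ++ []))
      output-final ws = trans (cong (output (algorithm is)) (trans (cong (λ m → final (algorithm is) G m ws) init≡memoryAt) (final-memoryAt [] ws)))
        (cong (outputState is) (decode-state is (stateAt is r (ws ʳ++ []))))

      states-memoryAt : ∀ {P : Memory → Set} l → (∀ vs → length vs ≤ l → P (memoryAt vs)) →
        ∀ vs ws → length vs + length ws ≤ l → All P (states (algorithm is) G (memoryAt vs) ws)
      states-memoryAt l h vs []       le = h vs (≤-trans (m≤m+n _ 0) le) ∷ []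
      states-memoryAt l h vs (v ∷ ws) le = h vs (≤-trans (m≤m+n _ _) le) ∷
        subst (λ m → All _ (states (algorithm is) G m ws)) (≡-sym (step-memoryAt v vs))
          (states-memoryAt l h (v ∷ vs) ws (≤-trans (≤-reflexive (≡-sym (+-suc (length vs) (length ws)))) le))

    module Correct {vs : List V} (p : vs ↭ allFin (suc n)) where
      seen : ∀ v → v ∈ vs
      seen v = Perm.∈-resp-↭ (↭-sym p) (Mem.∈-allFin v)

      candidates-sound : ∀ i s k → (∀ S → NonemptyProper S → k ≤ cutSize G S) → All (k ≤_) (candidates i (trialAt i s vs))
      candidates-sound i s k h = All.map⁺ (All.tabulate (λ {t} t∈ →
        let sp , lt = ∧≡true {isSplit (lookup t ∘ proj₂) (labelsOf f vs)}
                        (∈-filterᵇ⁻ (eligible i (trialAt i s vs) ∘ lookup) {bits (suc n)} t∈)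
        in subst (k ≤_)
          (trans (cutSize≡pairCut G (lookup t ∘ f) p) (trans (≡-sym (load-contracted f (lookup t) vs))
            (≡-sym (load-certificate-≡ (threshold i) (contracted f vs) (lookup t) (<ᵇ⇒< _ _ (subst T (≡-sym lt) _))))))
          (h (lookup t ∘ f) (isSplit⇒nonemptyProper vs (trans (≡-sym (isSplit-map (lookup t ∘ proj₂) (λ u → u , f u) vs)) sp)))))
        where
        f = centerOf i s

      allCandidates-sound : ∀ is r k → (∀ S → NonemptyProper S → k ≤ cutSize G S) → All (k ≤_) (allCandidates is (trialsAt is r vs))
      allCandidates-sound []       r k h = []
      allCandidates-sound (i ∷ is) r k h = All.++⁺ (candidates-sound i _ k h) (allCandidates-sound is _ k h)

      candidates-complete : ∀ i s S → NonemptyProper S → cutSize G S < threshold i →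
        keeps b (2 ^ (b ∸ i)) G S zero s ≡ true → ∃ λ x → x ∈ candidates i (trialAt i s vs) × x ≤ cutSize G S
      candidates-complete i s S np lt kept = load H (lookup t)
        , Mem.∈-map⁺ (load H ∘ lookup) (∈-filterᵇ⁺ (eligible i (trialAt i s vs) ∘ lookup) (∈-bits t) (cong₂ _∧_ split small))
        , load≤
        where
        f = centerOf i s
        H = certificate (threshold i) (contracted f vs)
        -- The set `S` itself is the witness: each label lies on the side of its vertex, so pulling
        -- `S` back along the labels returns `S`.
        t = Vec.tabulate S
        preserved : ∀ v → lookup t (f v) ≡ S v
        preserved v = trans (Vec.lookup∘tabulate S (f v))
          (not-xor⇒≡ (S (f v)) (S v) (all-∈ (λ v → not (S (f v) xor S v)) kept (Mem.∈-allFin v)))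
        load≤ : load H (lookup t) ≤ cutSize G S
        load≤ = begin
          load H (lookup t)                  ≤⟨ load-certificate-≤ (threshold i) (contracted f vs) (lookup t) ⟩
          load (contracted f vs) (lookup t)  ≡⟨ load-contracted f (lookup t) vs ⟩
          pairCut G (lookup t ∘ f) vs        ≡⟨ ≡-sym (cutSize≡pairCut G (lookup t ∘ f) p) ⟩
          cutSize G (lookup t ∘ f)           ≡⟨ cutSize-cong G preserved ⟩
          cutSize G S                        ∎
          where open ≤-Reasoning
        small : (load H (lookup t) <ᵇ threshold i) ≡ true
        small = T⇒≡true (<⇒<ᵇ (≤-<-trans load≤ lt))
        split : isSplit (lookup t ∘ proj₂) (labelsOf f vs) ≡ true
        split = trans (isSplit-map (lookup t ∘ proj₂) (λ u → u , f u) vs)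
          (nonemptyProper⇒isSplit seen (NonemptyProper-cong (λ v → ≡-sym (preserved v)) np))

      module _ (S : VSet (suc n)) (np : NonemptyProper S) (j : ℕ) (lt : cutSize G S < threshold j) where
        keep : ∀ i → Vec Bool (width i) → Bool
        keep i s = keeps b (2 ^ (b ∸ i)) G S zero s

        allCandidates-complete : ∀ is r → missed width keep j is r ≡ false →
          ∃ λ x → x ∈ allCandidates is (trialsAt is r vs) × x ≤ cutSize G S
        allCandidates-complete (i ∷ is) r e with j ≡ᵇ i in eq | keep i (take (width i) r) in kp
        ... | true  | true with refl ← ≡ᵇ⇒≡ j i (subst T (≡-sym eq) _) =
          let x , x∈ , le = candidates-complete i _ S np lt kp in x , Mem.∈-++⁺ˡ x∈ , le
        ... | true  | false = let x , x∈ , le = allCandidates-complete is _ e in x , Mem.∈-++⁺ʳ (candidates i (trialAt i (take (width i) r) vs)) x∈ , le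
        ... | false | _     = let x , x∈ , le = allCandidates-complete is _ e in x , Mem.∈-++⁺ʳ (candidates i (trialAt i (take (width i) r) vs)) x∈ , le

      bestAt≤degree : ∀ {ws v} → v ∈ ws → bestAt ws ≤ degree G v
      bestAt≤degree {w ∷ ws} (here refl) = m⊓n≤n (bestAt ws) _
      bestAt≤degree {w ∷ ws} (there i)   = ≤-trans (m⊓n≤m (bestAt ws) _) (bestAt≤degree i)

      ≤bestAt : ∀ {k} ws → k ≤ suc n → (∀ v → k ≤ degree G v) → k ≤ bestAt ws
      ≤bestAt []       h d = h
      ≤bestAt (w ∷ ws) h d = ⊓-glb (≤bestAt ws h d) (d w)

      output-correct : ∀ is r S → NonemptyProper S → (∀ S′ → NonemptyProper S′ → cutSize G S ≤ cutSize G S′) →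
        (∀ v → cutSize G S ≤ degree G v) →
        (∃ λ x → x ≤ cutSize G S × (x ∈ allCandidates is (trialsAt is r vs) ⊎ bestAt vs ≤ x)) →
        IsEdgeConnectivity G (outputState is (stateAt is r vs))
      output-correct is r S np min deg (x , x≤ , w) =
        subst (IsEdgeConnectivity G) (≤-antisym lower (upper w)) ((S , np , refl) , min)
        where
        lower : cutSize G S ≤ outputState is (stateAt is r vs)
        lower = ≤-foldr-⊓ (≤bestAt vs (≤-trans (deg zero) (degree≤n G zero)) deg) (allCandidates-sound is r _ min)
        upper : _ → outputState is (stateAt is r vs) ≤ cutSize G S
        upper (inj₁ i)  = ≤-trans (⊓-foldr-∈ (bestAt vs) i) x≤
        upper (inj₂ le) = ≤-trans (⊓-foldr-≤ (bestAt vs) (allCandidates is (trialsAt is r vs))) (≤-trans le x≤)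

-- Space

-- The summands are the random bits, then `l` stored labels and `h` certificate edges, each entry a
-- pair of `b`-bit vertices, with the unary lengths.
trialSpace-≤ : ∀ {b i n l h} → i < b → n ≤ 2 ^ b → l ≤ 2 ^ b →
  h ≤ 2 ^ suc i * suc (sampleCount b (2 ^ (b ∸ i))) →
  trialBits n b (2 ^ (b ∸ i)) + (1 + ((1 + l + l * (b + b)) + (1 + h + h * (b + b)))) ≤ 1535 * (b * b * 2 ^ b)
trialSpace-≤ {b@(suc b′)} {i} {n} {l} {h} i<b n≤ l≤ h≤ = begin
  (m * b + n * (12 + 2 * b)) + (1 + ((1 + l + l * (b + b)) + (1 + h + h * (b + b))))
    ≡⟨ rearr (m * b) (n * (12 + 2 * b)) l h b ⟩
  m * b + n * (12 + 2 * b) + l * (1 + 2 * b) + h * (1 + 2 * b) + 3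
    ≤⟨ +-mono-≤ (+-mono-≤ (+-mono-≤ (+-mono-≤ mb≤ nb≤) lb≤) hb≤) 3≤ ⟩
  216 * (b * b * Y) + 14 * (b * b * Y) + 3 * (b * b * Y) + 1299 * (b * b * Y) + 3 * (b * b * Y)
    ≡⟨ rearr′ (b * b * Y) ⟩
  1535 * (b * b * Y) ∎
  where
  open ≤-Reasoning
  Y = 2 ^ b
  k = 2 ^ i
  N = 2 ^ (b ∸ i)
  m = sampleCount b N
  rearr : ∀ x y l h b → x + y + (1 + ((1 + l + l * (b + b)) + (1 + h + h * (b + b))))
            ≡ x + y + l * (1 + 2 * b) + h * (1 + 2 * b) + 3
  rearr = solve-∀
  rearr′ : ∀ z → 216 * z + 14 * z + 3 * z + 1299 * z + 3 * z ≡ 1535 * z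
  rearr′ = solve-∀
  kN : k * N ≡ Y
  kN = trans (≡-sym (^-distribˡ-+-* 2 i (b ∸ i))) (cong (2 ^_) (m+[n∸m]≡n (<⇒≤ i<b)))
  N≤Y : N ≤ Y
  N≤Y = ^-monoʳ-≤ 2 (m∸n≤m b i)
  2+b≤ : 2 + b ≤ 3 * b
  2+b≤ = begin
    2 + b          ≤⟨ +-monoˡ-≤ b (m≤m*n 2 b) ⟩
    2 * b + b      ≡⟨ +-comm (2 * b) b ⟩
    3 * b          ∎
  1+2b≤ : 1 + 2 * b ≤ 3 * b
  1+2b≤ = +-monoˡ-≤ (2 * b) (s≤s z≤n)
  m≤ : m ≤ 216 * (b * N)
  m≤ = begin
    36 * N * (2 * (2 + b))   ≤⟨ *-monoʳ-≤ (36 * N) (*-monoʳ-≤ 2 2+b≤) ⟩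
    36 * N * (2 * (3 * b))   ≡⟨ eq N b ⟩
    216 * (b * N)            ∎
    where
    eq : ∀ N b → 36 * N * (2 * (3 * b)) ≡ 216 * (b * N)
    eq = solve-∀
  mb≤ : m * b ≤ 216 * (b * b * Y)
  mb≤ = begin
    m * b                    ≤⟨ *-monoˡ-≤ b m≤ ⟩
    216 * (b * N) * b        ≡⟨ eq b N ⟩
    216 * (b * b * N)        ≤⟨ *-monoʳ-≤ 216 (*-monoʳ-≤ (b * b) N≤Y) ⟩
    216 * (b * b * Y)        ∎
    where
    eq : ∀ b N → 216 * (b * N) * b ≡ 216 * (b * b * N)
    eq = solve-∀
  b≤bb : b ≤ b * b
  b≤bb = m≤m*n b b
  nb≤ : n * (12 + 2 * b) ≤ 14 * (b * b * Y)
  nb≤ = begin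
    n * (12 + 2 * b)           ≤⟨ *-mono-≤ n≤ (+-monoˡ-≤ (2 * b) (m≤m*n 12 b)) ⟩
    Y * (12 * b + 2 * b)       ≡⟨ eq Y b ⟩
    14 * (b * Y)               ≤⟨ *-monoʳ-≤ 14 (*-monoˡ-≤ Y b≤bb) ⟩
    14 * (b * b * Y)           ∎
    where
    eq : ∀ Y b → Y * (12 * b + 2 * b) ≡ 14 * (b * Y)
    eq = solve-∀
  lb≤ : l * (1 + 2 * b) ≤ 3 * (b * b * Y)
  lb≤ = begin
    l * (1 + 2 * b)            ≤⟨ *-mono-≤ l≤ 1+2b≤ ⟩
    Y * (3 * b)                ≡⟨ eq Y b ⟩
    3 * (b * Y)                ≤⟨ *-monoʳ-≤ 3 (*-monoˡ-≤ Y b≤bb) ⟩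
    3 * (b * b * Y)            ∎
    where
    eq : ∀ Y b → Y * (3 * b) ≡ 3 * (b * Y)
    eq = solve-∀
  -- The trade-off between scales: the threshold grows like `k`, the table shrinks like `N`, and
  -- `k * N` is `2 ^ b` at every scale.
  h≤′ : h ≤ 433 * (b * Y)
  h≤′ = begin
    h                          ≤⟨ h≤ ⟩
    2 ^ suc i * suc m          ≡⟨ *-suc (2 ^ suc i) m ⟩
    2 ^ suc i + 2 * k * m      ≤⟨ +-mono-≤ (≤-trans (^-monoʳ-≤ 2 i<b) (m≤n*m Y b)) (*-monoʳ-≤ (2 * k) m≤) ⟩
    b * Y + 2 * k * (216 * (b * N)) ≡⟨ eq b Y k N ⟩
    b * Y + 432 * (b * (k * N)) ≡⟨ cong (λ z → b * Y + 432 * (b * z)) kN ⟩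
    433 * (b * Y)              ∎
    where
    eq : ∀ b Y k N → b * Y + 2 * k * (216 * (b * N)) ≡ b * Y + 432 * (b * (k * N))
    eq = solve-∀
  hb≤ : h * (1 + 2 * b) ≤ 1299 * (b * b * Y)
  hb≤ = begin
    h * (1 + 2 * b)            ≤⟨ *-mono-≤ h≤′ 1+2b≤ ⟩
    433 * (b * Y) * (3 * b)    ≡⟨ eq b Y ⟩
    1299 * (b * b * Y)         ∎
    where
    eq : ∀ b Y → 433 * (b * Y) * (3 * b) ≡ 1299 * (b * b * Y)
    eq = solve-∀
  3≤ : 3 ≤ 3 * (b * b * Y)
  3≤ = *-monoʳ-≤ 3 (*-mono-≤ {1} {b * b} {1} {Y} (s≤s z≤n) (m^n>0 2 b))

module Space {n : ℕ} (b : ℕ) (n<2^b : suc n ≤ 2 ^ b) (G : Graph (suc n)) where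
  open Algorithm {n} b n<2^b

  private
    -- The vertex `zero` is the default label of a vertex without a neighbour in the table.
    U : ∀ i → Vec Bool (width i) → List V
    U i s = zero ∷ centers b (2 ^ (b ∸ i)) (take (sampleCount b (2 ^ (b ∸ i)) * b) s)

  centerOf∈U : ∀ i s v → centerOf G i s v ∈ U i s
  centerOf∈U i s v with pick-∈ zero (filterᵇ (adj G v) (centers b (2 ^ (b ∸ i)) (take (sampleCount b (2 ^ (b ∸ i)) * b) s)))
                             (value (block (drop (sampleCount b (2 ^ (b ∸ i)) * b) s) v))
  ... | here e  = here e
  ... | there j = there (proj₁ (Mem.∈-filter⁻ (T? ∘ adj G v) j))

  contracted-within : ∀ i s vs → All (Within (U i s)) (contracted G (centerOf G i s) vs)
  contracted-within i s []       = []
  contracted-within i s (v ∷ vs) = All.++⁺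
    (All.map⁺ (All.filter⁺ (T? ∘ adj G v ∘ proj₁)
      (All.map⁺ (All.universal (λ u → centerOf∈U i s v , centerOf∈U i s u) vs))))
    (contracted-within i s vs)

  length-edges : ∀ is (es : List (V × V)) → length (encode (edgesCodec is) es) ≡ 1 + length es + length es * (b + b)
  length-edges is es = trans (length-list (pairCodec (vertexCodec b n<2^b) (vertexCodec b n<2^b)) es)
    (cong (suc (length es) +_) (trans (∑-cong es (λ (x , y) → trans (length-pair (vertexCodec b n<2^b) (vertexCodec b n<2^b) x y)
      (cong₂ _+_ (length-vertex b n<2^b x) (length-vertex b n<2^b y)))) (∑-const es (b + b))))

  module _ (vs : List V) (vs≤ : length vs ≤ suc n) where
    trialAt-space : ∀ is i s → i < b →
      width i + (1 + length (encode (pairCodec (edgesCodec is) (edgesCodec is)) (trialAt G i s vs))) ≤ 1535 * (b * b * 2 ^ b)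
    trialAt-space is i s i<b = subst (λ z → width i + (1 + z) ≤ 1535 * (b * b * 2 ^ b))
      (≡-sym (trans (length-pair (edgesCodec is) (edgesCodec is) labels H) (cong₂ _+_
        (trans (length-edges is labels) (cong (λ l → 1 + l + l * (b + b)) (List.length-map (λ u → u , centerOf G i s u) vs)))
        (length-edges is H))))
      (trialSpace-≤ {b} {i} {suc n} i<b n<2^b (≤-trans vs≤ n<2^b) (≤-trans
        (length-certificate (U i s) (threshold i) _ (contracted-within i s vs) (s≤s z≤n))
        (*-monoʳ-≤ (threshold i) (s≤s (≤-trans (length-catMaybes-≤ (samples m x)) (≤-reflexive (length-samples m x)))))))
      where
      m = sampleCount b (2 ^ (b ∸ i))
      x = take (m * b) s
      labels = proj₁ (trialAt G i s vs)
      H = proj₂ (trialAt G i s vs)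

    -- The codec is parametrised by the full list of trials, which must stay fixed while the
    -- induction shortens `is`; hence the separate `js`.
    trialsAt-space : ∀ js is r → (∀ {i} → i ∈ is → i < b) →
      ∑ is width + (length (trialsAt G is r vs) + ∑ (trialsAt G is r vs) (length ∘ encode (pairCodec (edgesCodec js) (edgesCodec js))))
        ≤ length is * (1535 * (b * b * 2 ^ b))
    trialsAt-space js []       r h = z≤n
    trialsAt-space js (i ∷ is) r h = ≤-trans
      (≤-reflexive (rearr (width i) (∑ is width) (length ts) _ (∑ ts (length ∘ encode (pairCodec (edgesCodec js) (edgesCodec js))))))
      (+-mono-≤ (trialAt-space js i (take (width i) r) (h (here refl))) (trialsAt-space js is (drop (width i) r) (h ∘ there)))
      where
      ts = trialsAt G is (drop (width i) r) vs
      rearr : ∀ w ws l x y → w + ws + (1 + l + (x + y)) ≡ (w + (1 + x)) + (ws + (l + y))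
      rearr = solve-∀

    bestAt-≤ : ∀ ws → bestAt G ws ≤ suc n
    bestAt-≤ []       = ≤-refl
    bestAt-≤ (w ∷ ws) = ≤-trans (m⊓n≤m (bestAt G ws) _) (bestAt-≤ ws)

    memoryAt-space : ∀ is r → (∀ {i} → i ∈ is → i < b) →
      length (memoryAt G is r vs) ≤ 2 + suc n + length is * (1535 * (b * b * 2 ^ b))
    memoryAt-space is r h = begin
      length (memoryAt G is r vs)
        ≡⟨ trans (length-pair (bitsCodec (∑ is width)) rest r (bestAt G vs , ts)) (cong₂ _+_ (Vec.length-toList r)
             (trans (length-pair unaryCodec (listCodec tc) (bestAt G vs) ts) (cong₂ _+_ (length-unary (bestAt G vs)) (length-list tc ts)))) ⟩
      ∑ is width + (suc (bestAt G vs) + (suc (length ts) + ∑ ts (length ∘ encode tc)))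
        ≡⟨ rearr (∑ is width) (bestAt G vs) (length ts) _ ⟩
      2 + bestAt G vs + (∑ is width + (length ts + ∑ ts (length ∘ encode tc)))
        ≤⟨ +-mono-≤ (+-monoʳ-≤ 2 (bestAt-≤ vs)) (trialsAt-space is is r h) ⟩
      2 + suc n + length is * (1535 * (b * b * 2 ^ b)) ∎
      where
      open ≤-Reasoning
      ts = trialsAt G is r vs
      tc = pairCodec (edgesCodec is) (edgesCodec is)
      rest = pairCodec unaryCodec (listCodec tc)
      rearr : ∀ w x l y → w + (1 + x + (1 + l + y)) ≡ 2 + x + (w + (l + y))
      rearr = solve-∀

2^⌊log₂n⌋≤1+n : ∀ n → 2 ^ ⌊log₂ n ⌋ ≤ suc n
2^⌊log₂n⌋≤1+n zero    = ≤-refl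
2^⌊log₂n⌋≤1+n (suc n) = m≤n⇒m≤1+n (2^⌊log₂n⌋≤n (suc n) (s≤s z≤n))

-- Of the four factors `b`, two come from the size of one trial, one from the number of scales and
-- one from the repetitions per scale.
space-bound : ∀ {n b} Q → 2 ≤ n → 1 ≤ b → 2 ^ b ≤ 2 * n →
              2 + n + Q * b * b * (1535 * (b * b * 2 ^ b)) ≤ (2 + 3070 * Q) * n * b ^ 4
space-bound {n} {b} Q 2≤n 1≤b 2^b≤2n = begin
  2 + n + Q * b * b * (1535 * (b * b * 2 ^ b))    ≤⟨ +-mono-≤ (+-monoˡ-≤ n 2≤n) (*-monoʳ-≤ (Q * b * b) (*-monoʳ-≤ 1535 (*-monoʳ-≤ (b * b) 2^b≤2n))) ⟩
  n + n + Q * b * b * (1535 * (b * b * (2 * n)))  ≡⟨ eq n Q b ⟩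
  2 * n * 1 + 3070 * Q * n * b ^ 4                ≤⟨ +-monoˡ-≤ (3070 * Q * n * b ^ 4) (*-monoʳ-≤ (2 * n) (m^n>0 b {{>-nonZero 1≤b}} 4)) ⟩
  2 * n * b ^ 4 + 3070 * Q * n * b ^ 4            ≡⟨ eq′ n Q (b ^ 4) ⟩
  (2 + 3070 * Q) * n * b ^ 4                      ∎
  where
  open ≤-Reasoning
  eq : ∀ n Q b → n + n + Q * b * b * (1535 * (b * b * (2 * n)))
         ≡ 2 * n * 1 + 3070 * Q * n * (b * (b * (b * (b * 1))))
  eq = solve-∀
  eq′ : ∀ n Q z → 2 * n * z + 3070 * Q * n * z ≡ (2 + 3070 * Q) * n * z
  eq′ = solve-∀

repetition : ℕ → ℕ → List ℕ
repetition t b = concat (replicate t (upTo b))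

repetition-< : ∀ t {b i} → i ∈ repetition t b → i < b
repetition-< t j = Mem.∈-upTo⁻ (∈-repeat⁻ t j)

length-repetition : ∀ t b → length (repetition t b) ≡ t * b
length-repetition t b = trans (length≡∑ (repetition t b)) (trans (∑-repeat t (upTo b) (const 1))
  (cong (t *_) (trans (≡-sym (length≡∑ (upTo b))) (List.length-upTo b))))

-- Assembly of the space bound and the failure probability.

module Main (κ P : ℕ) (κ≥ : 9216 ≤ κ) (P≡ : suc P ≡ 4 * 8 ^ κ) (c n′ b : ℕ)
  (n<2^b : suc (suc n′) < 2 ^ b) (2^b≤2n : 2 ^ b ≤ 2 * suc (suc n′)) (0<b : 0 < b)
  (G : Graph (suc (suc n′))) (order : List (Fin (suc (suc n′)))) (p : order ↭ allFin (suc (suc n′))) where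
  private
    n : ℕ
    n = suc (suc n′)

    -- A trial at the right scale succeeds with probability at least `1 / (1 + P)`, so this many
    -- repetitions all fail with probability at most `2 ^ (- c * b)`, which is at most `n ^ (- c)`.
    t : ℕ
    t = suc P * (c * b)

    is : List ℕ
    is = repetition t b

    n≤ : n ≤ 2 ^ b
    n≤ = <⇒≤ n<2^b

    open Algorithm {suc n′} b n≤
    open Space {suc n′} b n≤ G

    vs : List (Fin n)
    vs = order ʳ++ []

    vs↭ : vs ↭ allFin n
    vs↭ = ↭-trans (Perm.↭-reverse order) p

    open Correct G vs↭

  space : ∀ r → All (λ m → length m ≤ (2 + 3070 * (suc P * c)) * n * b ^ 4)
                    (states (algorithm is) G (init (algorithm is) r) order)
  space r = subst (λ m → All _ (states (algorithm is) G m order)) (≡-sym (init≡memoryAt G is r))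
    (states-memoryAt G is r n (λ ws le → ≤-trans (memoryAt-space ws le is r (repetition-< t)) bound) [] order
      (≤-reflexive (trans (Perm.↭-length p) (List.length-tabulate {n = n} id))))
    where
    bound : 2 + n + length is * (1535 * (b * b * 2 ^ b)) ≤ (2 + 3070 * (suc P * c)) * n * b ^ 4
    bound = subst (λ l → 2 + n + l * (1535 * (b * b * 2 ^ b)) ≤ (2 + 3070 * (suc P * c)) * n * b ^ 4)
      (trans (cong (_* b) (*-assoc (suc P) c b)) (≡-sym (length-repetition t b)))
      (space-bound (suc P * c) (s≤s (s≤s z≤n)) 0<b 2^b≤2n)

  correct : Σ (List (Vec Bool (∑ is width))) λ Bad →
    (length Bad * n ^ c ≤ 2 ^ ∑ is width) ×
    (∀ r → r ∉ Bad → IsEdgeConnectivity G (output (algorithm is) (final (algorithm is) G (init (algorithm is) r) order)))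
  correct with minimum-cut G
  ... | S , np , min with any (λ v → degree G v ≤ᵇ cutSize G S) (allFin n) in eq
  -- Some degree equals the minimum cut, and the running minimum of degrees is correct for every
  -- random string.
  ...   | true = [] , z≤n , λ r _ → subst (IsEdgeConnectivity G) (≡-sym (output-final G is r order))
      (output-correct is r S np min deg (degree G v , ≤ᵇ⇒≤ _ _ (subst T (≡-sym le) _) , inj₂ (bestAt≤degree (seen v))))
    where
    deg : ∀ v → cutSize G S ≤ degree G v
    deg v = ≤-trans (min _ (singleton-nonemptyProper v)) (≤-reflexive (cutSize-singleton G v))
    small = any-true (λ v → degree G v ≤ᵇ cutSize G S) (allFin n) eq
    v = proj₁ small
    le = proj₂ (proj₂ small)
  ...   | false = filterᵇ miss (bits (∑ is width)) , rare , λ r r∉ → subst (IsEdgeConnectivity G) (≡-sym (output-final G is r order))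
      (output-correct is r S np min (λ v → <⇒≤ (lt v))
        (let x , x∈ , x≤ = allCandidates-complete S np j <threshold is r (not-missed r r∉) in x , x≤ , inj₁ x∈))
    where
    open ≤-Reasoning
    cut = cutSize G S
    lt : ∀ v → cut < degree G v
    lt v = ≰⇒> (λ le → true≢false (trans (≡-sym (T⇒≡true (≤⇒≤ᵇ le))) (any-false (λ v → degree G v ≤ᵇ cut) eq (Mem.∈-allFin v))))
    -- A disconnected graph has cut 0, where the logarithm is 0 and `k` is 1. So `k` is bounded by
    -- `1 + cut` only, which still suffices because every degree exceeds the cut.
    j = ⌊log₂ cut ⌋
    k = 2 ^ j
    N = 2 ^ (b ∸ j)
    <threshold : cut < threshold j
    <threshold = n<2^[1+⌊log₂n⌋] cut
    k≤degree : ∀ v → k ≤ degree G v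
    k≤degree v = ≤-trans (2^⌊log₂n⌋≤1+n cut) (lt v)
    -- The scale is among those tried, since `k` is at most a degree and so lies below `2 ^ b`.
    j<b : j < b
    j<b = ≰⇒> (λ b≤j → <⇒≱ n<2^b (≤-trans (^-monoʳ-≤ 2 b≤j) (≤-trans (k≤degree zero) (degree≤n G zero))))
    crossing≤same = minimum-cut-crossing≤same G S min lt
    k≤same : ∀ v → k ≤ 2 * ∑ (allFin n) (same G S v)
    k≤same v = begin
      k                                  ≤⟨ k≤degree v ⟩
      degree G v                         ≡⟨ ≡-sym (crossing+same≡degree G S v) ⟩
      ∑ (allFin n) (crossing G S v) + ∑ (allFin n) (same G S v) ≤⟨ +-mono-≤ (crossing≤same v) (≤-reflexive (≡-sym (+-identityʳ _))) ⟩
      2 * ∑ (allFin n) (same G S v)      ∎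
    crossing≤ : ∑ (allFin n) (λ v → ∑ (allFin n) (crossing G S v)) ≤ 4 * k
    crossing≤ = begin
      ∑ (allFin n) (λ v → ∑ (allFin n) (crossing G S v)) ≡⟨ ∑-crossing G S ⟩
      2 * cut                            ≤⟨ *-monoʳ-≤ 2 (<⇒≤ <threshold) ⟩
      2 * (2 * k)                        ≡⟨ ≡-sym (*-assoc 2 2 k) ⟩
      4 * k                              ∎
    miss = missed width (keep S np j <threshold) j is
    not-missed : ∀ r → r ∉ filterᵇ miss (bits (∑ is width)) → miss r ≡ false
    not-missed r r∉ with miss r in e
    ... | false = refl
    ... | true  = ⊥-elim (r∉ (∈-filterᵇ⁺ miss (∈-bits r) e))
    keep-count : 2 ^ width j ≤ suc P * ∑ (bits (width j)) (𝟙 ∘ keep S np j <threshold j)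
    keep-count = ≤-trans (Trial.keeps-count κ κ≥ b k N G S zero n≤
        (trans (≡-sym (^-distribˡ-+-* 2 j (b ∸ j))) (cong (2 ^_) (m+[n∸m]≡n (<⇒≤ j<b)))) crossing≤same k≤same crossing≤)
      (≤-reflexive (cong (_* ∑ (bits (width j)) (𝟙 ∘ keep S np j <threshold j)) (≡-sym P≡)))
    repetitions : t ≤ ∑ is (λ i → 𝟙 (j ≡ᵇ i))
    repetitions = begin
      t                                  ≡⟨ ≡-sym (*-identityʳ _) ⟩
      t * 1                ≤⟨ *-monoʳ-≤ t (subst (λ z → 𝟙 z ≤ ∑ (upTo b) (λ i → 𝟙 (j ≡ᵇ i))) (T⇒≡true (≡⇒≡ᵇ j j refl)) (∈⇒≤∑ (λ i → 𝟙 (j ≡ᵇ i)) (Mem.∈-upTo⁺ j<b))) ⟩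
      t * ∑ (upTo b) (λ i → 𝟙 (j ≡ᵇ i)) ≡⟨ ≡-sym (∑-repeat t (upTo b) (λ i → 𝟙 (j ≡ᵇ i))) ⟩
      ∑ is (λ i → 𝟙 (j ≡ᵇ i))            ∎
    rare : length (filterᵇ miss (bits (∑ is width))) * n ^ c ≤ 2 ^ ∑ is width
    rare = begin
      length (filterᵇ miss (bits (∑ is width))) * n ^ c ≡⟨ cong (_* n ^ c) (length-filter≡∑ (bits (∑ is width)) miss) ⟩
      ∑ (bits (∑ is width)) (𝟙 ∘ miss) * n ^ c          ≤⟨ *-monoʳ-≤ (∑ (bits (∑ is width)) (𝟙 ∘ miss)) (≤-trans (^-monoˡ-≤ c n≤) (≤-reflexive (trans (^-*-assoc 2 b c) (cong (2 ^_) (*-comm b c))))) ⟩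
      ∑ (bits (∑ is width)) (𝟙 ∘ miss) * 2 ^ (c * b)    ≤⟨ missed-rare width (keep S np j <threshold) j P keep-count is (c * b) repetitions ⟩
      2 ^ ∑ is width                                    ∎

-- κ is kept a variable because 8 ^ 9216 must not be normalised.
module Assembled (κ : ℕ) (κ≥ : 9216 ≤ κ) (c : ℕ) where
  P : ℕ
  P = pred (4 * 8 ^ κ)

  bitLength : ℕ → ℕ
  bitLength n = suc ⌊log₂ n ⌋

  algorithms : (n : ℕ) → StreamAlg n
  algorithms zero    = record { randBits = 0 ; init = λ _ → [] ; step = λ m _ _ → m ; output = λ _ → 0 }
  algorithms (suc n) = Algorithm.algorithm (bitLength (suc n)) (<⇒≤ (n<2^[1+⌊log₂n⌋] (suc n)))
                         (repetition (suc P * (c * bitLength (suc n))) (bitLength (suc n)))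

  spaceFactor : ℕ
  spaceFactor = 2 + 3070 * (suc P * c)

  Guarantee : (n : ℕ) → Graph n → List (Fin n) → Set
  Guarantee n G order =
    (∀ r → All (λ m → length m ≤ softLinear spaceFactor 4 n) (states (algorithms n) G (init (algorithms n) r) order))
    ×
    Σ (List (Vec Bool (randBits (algorithms n)))) λ Bad →
      (length Bad * n ^ c ≤ 2 ^ randBits (algorithms n)) ×
      (∀ r → r ∉ Bad → IsEdgeConnectivity G (output (algorithms n) (final (algorithms n) G (init (algorithms n) r) order)))

  guarantee : ∀ n → n ≥ 2 → (G : Graph n) (order : List (Fin n)) → order ↭ allFin n → Guarantee n G order
  guarantee (suc zero) (s≤s ()) _ _ _
  guarantee (suc (suc n)) _ G order p = M.space , M.correct
    where
    module M = Main κ P κ≥ (suc-pred (4 * 8 ^ κ) {{m*n≢0 4 (8 ^ κ) {{_}} {{m^n≢0 8 κ}}}}) c n (bitLength (suc (suc n)))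
      (n<2^[1+⌊log₂n⌋] (suc (suc n))) (*-monoʳ-≤ 2 (2^⌊log₂n⌋≤n (suc (suc n)) (s≤s z≤n))) (s≤s z≤n) G order p

theorem4p15 : (c : ℕ) →
    Σ ((n : ℕ) → StreamAlg n) λ A →
    ∃ λ K → ∃ λ k →
    ∀ (n : ℕ) → n ≥ 2 → (G : Graph n) → (order : List (Fin n)) → order ↭ allFin n →
      -- space: every memory state of the pass, for every random string, is Õ(n) bits
      (∀ (r : Vec Bool (randBits (A n))) →
        All (λ m → length m ≤ softLinear K k n) (states (A n) G (init (A n) r) order))
      ×
      -- correctness w.h.p.: the failing random strings are at most a 1/n^c fraction
      (Σ (List (Vec Bool (randBits (A n)))) λ Bad →
        (length Bad * n ^ c ≤ 2 ^ randBits (A n)) ×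
        (∀ (r : Vec Bool (randBits (A n))) → r ∉ Bad →
          IsEdgeConnectivity G (output (A n) (final (A n) G (init (A n) r) order))))
theorem4p15 c = A.algorithms , A.spaceFactor , 4 , A.guarantee
  where module A = Assembled 9216 ≤-refl c
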